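{- Consider a Boolean formula that is a conjunction of constraints of the following two kinds: (i) statements $\oplus_{\le1}(A_{i1},\dots,A_{iL_i})$ and (ii) clauses $\bigvee(A_{j1},\dots,A_{jM_j})=A_{j1}\vee\dots\vee A_{jM_j}$ consisting of positive literals (variables), such that: each variable occurs at most once in total across all the $\oplus_{\le1}$ statements; and the $\bigvee$ clauses can be divided into two groups, where each variable occurs at most once in total across the clauses of the first group, and each clause of the second group has as its set of variables a subset of the variables of some single $\oplus_{\le1}$ statement. The satisfiability of such formulas can be decided in polynomial time (by translation to the Symmetric Marriage Problem).
   Context: $\oplus_{\le1}(A_1,\dots,A_N)$ is true iff at most one of $A_1,\dots,A_N$ is true; equivalently it is the CNF $\bigwedge_{1\le i<j\le N}(\neg A_i\vee\neg A_j)$. The Symmetric Marriage Problem: given finite sets of girls $G$ and boys $B$, subsets $G_L\subseteq G$, $B_L\subseteq B$ and lists $\mathscr{T}_g\subseteq B$ ($g\in G_L$), $\mathscr{T}_b\subseteq G$ ($b\in B_L$), decide whether there is a set of disjoint girl–boy pairs covering all of $G_L\cup B_L$ such that each listed person's partner is on that person's list. -}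

module Defs where

open import Data.Bool using (Bool; true; false; T)
open import Data.Fin using (Fin)
open import Data.Fin.Subset using (Subset) renaming (_∈_ to _∈ˢ_)
open import Data.List using (List; []; _∷_; map; concat; foldr)
open import Data.List.Membership.Propositional using (_∈_)
open import Data.List.Relation.Binary.Subset.Propositional using (_⊆_)
open import Data.List.Relation.Ternary.Interleaving.Propositional using (Interleaving)
open import Data.List.Relation.Unary.All using (All)
open import Data.List.Relation.Unary.AllPairs using (AllPairs)
open import Data.List.Relation.Unary.Any using (Any)
open import Data.List.Relation.Unary.Unique.Propositional using (Unique)
open import Data.Maybe using (Maybe; just; nothing; Is-just)
import Data.Maybe.Relation.Unary.All as Maybe
open import Data.Nat using (ℕ; suc; _+_; _*_; _≤_)
open import Data.Product using (Σ; ∃-syntax; _×_; _,_; proj₁; proj₂)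
open import Data.Sum using (_⊎_)
open import Data.Unit using (⊤)
open import Data.Vec using (Vec; lookup; replicate; toList; head; _[_]≔_) renaming (_∷_ to _∷ᵛ_)
open import Function.Bundles using (_⇔_)
open import Relation.Binary.PropositionalEquality using (_≡_; _≢_)
open import Relation.Nullary using (¬_; Dec; does)

-- The model of computation is the language WHILE of N. D. Jones,
-- "Computability and Complexity from a Programming Perspective" (MIT
-- Press, 1997): imperative programs over binary trees, in which every
-- elementary operation takes one unit of time.  There is no primitive
-- equality test.  With trees stored as shared heap cells, t steps allocate
-- only O(t) new cells, so a Turing machine simulates them in time
-- polynomial in t and the input size; conversely WHILE simulates Turing
-- machines with at most polynomial overhead.

infixr 5 _∙_

data Tree : Set where
  nil : Tree
  _∙_ : Tree → Tree → Tree

size : Tree → ℕ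
size nil     = 1
size (a ∙ b) = suc (size a + size b)

left right : Tree → Tree
left  nil     = nil
left  (a ∙ _) = a
right nil     = nil
right (_ ∙ b) = b

data Expr (k : ℕ) : Set where
  var   : Fin k → Expr k
  nil   : Expr k
  cons  : Expr k → Expr k → Expr k
  hd tl : Expr k → Expr k

infixr 4 _⨾_
infix  5 _:=_

data Command (k : ℕ) : Set where
  skip    : Command k
  _:=_    : Fin k → Expr k → Command k
  _⨾_     : Command k → Command k → Command k
  if_then_else_ : Expr k → Command k → Command k → Command k
  while_loop_  : Expr k → Command k → Command k

Store : ℕ → Set
Store k = Vec Tree k

eval : ∀ {k} → Expr k → Store k → Tree
eval (var i)    σ = lookup σ i
eval nil        σ = nil
eval (cons a b) σ = eval a σ ∙ eval b σ
eval (hd a)     σ = left (eval a σ)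
eval (tl a)     σ = right (eval a σ)

cost : ∀ {k} → Expr k → ℕ
cost (var _)    = 1
cost nil        = 1
cost (cons a b) = suc (cost a + cost b)
cost (hd a)     = suc (cost a)
cost (tl a)     = suc (cost a)

-- c ⊢ σ ⇓ τ [ t ]: started in store σ, the command c terminates in store τ
-- after exactly t units of time.  As a condition, nil means false and every
-- other tree means true.

infix 3 _⊢_⇓_[_]

data _⊢_⇓_[_] {k : ℕ} : Command k → Store k → Store k → ℕ → Set where

  skip : ∀ {σ} → skip ⊢ σ ⇓ σ [ 1 ]

  assign : ∀ {i e σ} →
    i := e ⊢ σ ⇓ σ [ i ]≔ eval e σ [ suc (cost e) ]

  seq : ∀ {c d σ τ υ s t} →
    c ⊢ σ ⇓ τ [ s ] → d ⊢ τ ⇓ υ [ t ] → c ⨾ d ⊢ σ ⇓ υ [ s + t ]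

  if-true : ∀ {e c d σ τ t} → eval e σ ≢ nil →
    c ⊢ σ ⇓ τ [ t ] → if e then c else d ⊢ σ ⇓ τ [ suc (cost e + t) ]

  if-false : ∀ {e c d σ τ t} → eval e σ ≡ nil →
    d ⊢ σ ⇓ τ [ t ] → if e then c else d ⊢ σ ⇓ τ [ suc (cost e + t) ]

  while-true : ∀ {e c σ τ υ s t} → eval e σ ≢ nil →
    c ⊢ σ ⇓ τ [ s ] → while e loop c ⊢ τ ⇓ υ [ t ] →
    while e loop c ⊢ σ ⇓ υ [ suc (cost e + (s + t)) ]

  while-false : ∀ {e c σ} → eval e σ ≡ nil →
    while e loop c ⊢ σ ⇓ σ [ suc (cost e) ]

-- Input and output are passed in the first variable; the `extra` remaining
-- variables are initially nil.

record Program : Set where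
  constructor program
  field
    extra : ℕ
    body  : Command (suc extra)

_maps_to_within_ : Program → Tree → Tree → ℕ → Set
program extra body maps x to y within bound =
  ∃[ σ ] ∃[ t ] (body ⊢ x ∷ᵛ replicate extra nil ⇓ σ [ t ])
              × head σ ≡ y × t ≤ bound

-- Coefficients are listed from the constant term upwards.

Polynomial : Set
Polynomial = List ℕ

⟦_⟧ : Polynomial → ℕ → ℕ
⟦ p ⟧ n = foldr (λ a r → a + n * r) 0 p

-- Programs are only required to behave correctly on (encodings of)
-- instances satisfying the promise.

record Problem : Set₁ where
  field
    Instance : Set
    encode   : Instance → Tree
    Promise  : Instance → Set
    Yes      : Instance → Set

encodeBool : Bool → Tree
encodeBool false = nil
encodeBool true  = nil ∙ nil

DecidableInPolynomialTime : Problem → Set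
DecidableInPolynomialTime P =
  Σ Program λ prog → Σ Polynomial λ p →
    ∀ x → Promise x →
      Σ (Dec (Yes x)) λ d →
        prog maps encode x to encodeBool (does d) within ⟦ p ⟧ (size (encode x))
  where open Problem P

-- Polynomial-time many-one reducibility.  Because of sharing, a program can
-- build a tree whose written-out size exceeds its running time, so the
-- output size is bounded separately.

infix 4 _≤ᵖ_

_≤ᵖ_ : Problem → Problem → Set
P ≤ᵖ Q =
  Σ Program λ prog → Σ Polynomial λ p →
    ∀ x → P.Promise x →
      Σ Q.Instance λ y → Q.Promise y × (P.Yes x ⇔ Q.Yes y)
        × (prog maps P.encode x to Q.encode y within ⟦ p ⟧ (size (P.encode x)))
        × size (Q.encode y) ≤ ⟦ p ⟧ (size (P.encode x))
  where
  module P = Problem P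
  module Q = Problem Q

encodeList : ∀ {A : Set} → (A → Tree) → List A → Tree
encodeList enc []       = nil
encodeList enc (x ∷ xs) = enc x ∙ encodeList enc xs

encodeMaybe : ∀ {A : Set} → (A → Tree) → Maybe A → Tree
encodeMaybe enc nothing  = nil
encodeMaybe enc (just x) = enc x ∙ nil

-- Variables are named by binary words, so that n variables can be named in
-- O(log n) space each and the input size is not artificially inflated.

Variable : Set
Variable = List Bool

data Constraint : Set where
  ⊕≤1 : List Variable → Constraint
  ⋁   : List Variable → Constraint

Formula : Set
Formula = List Constraint

Assignment : Set
Assignment = Variable → Bool

infix 4 _⊨_

_⊨_ : Assignment → Constraint → Set
α ⊨ ⊕≤1 as = AllPairs (λ a b → ¬ T (α a) ⊎ ¬ T (α b)) as
α ⊨ ⋁ as   = Any (λ a → T (α a)) as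

Satisfiable : Formula → Set
Satisfiable φ = Σ Assignment λ α → All (α ⊨_) φ

atMostOnes clauses : Formula → List (List Variable)
atMostOnes []           = []
atMostOnes (⊕≤1 as ∷ φ) = as ∷ atMostOnes φ
atMostOnes (⋁ _ ∷ φ)    = atMostOnes φ
clauses []          = []
clauses (⊕≤1 _ ∷ φ) = clauses φ
clauses (⋁ as ∷ φ)  = as ∷ clauses φ

-- `Unique (concat xss)` says that each variable occurs at most once in
-- total across the lists xss, repetitions within a single list included.

record Admissible (φ : Formula) : Set where
  field
    atMostOnes-unique : Unique (concat (atMostOnes φ))
    group₁ group₂     : List (List Variable)
    grouping          : Interleaving group₁ group₂ (clauses φ)
    group₁-unique     : Unique (concat group₁)
    group₂-local      : All (λ c → Any (c ⊆_) (atMostOnes φ)) group₂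

encodeVariable : Variable → Tree
encodeVariable = encodeList encodeBool

encodeConstraint : Constraint → Tree
encodeConstraint (⊕≤1 as) = encodeBool false ∙ encodeList encodeVariable as
encodeConstraint (⋁ as)   = encodeBool true  ∙ encodeList encodeVariable as

AdmissibleSAT : Problem
AdmissibleSAT = record
  { Instance = Formula
  ; encode   = encodeList encodeConstraint
  ; Promise  = Admissible
  ; Yes      = Satisfiable
  }

-- The girls are Fin girls, the boys Fin boys.  The persons in G_L and B_L
-- are those whose entry is `just` their list.

record Marriage : Set where
  field
    girls boys : ℕ
    girlLists  : Vec (Maybe (Subset boys)) girls
    boyLists   : Vec (Maybe (Subset girls)) boys

record Solution (I : Marriage) : Set where
  open Marriage I
  field
    pairs        : List (Fin girls × Fin boys)
    disjoint     : AllPairs (λ p q → proj₁ p ≢ proj₁ q × proj₂ p ≢ proj₂ q) pairs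
    covers-girls : ∀ g → Is-just (lookup girlLists g) → g ∈ map proj₁ pairs
    covers-boys  : ∀ b → Is-just (lookup boyLists b) → b ∈ map proj₂ pairs
    girls-accept : All (λ p → Maybe.All (proj₂ p ∈ˢ_) (lookup girlLists (proj₁ p))) pairs
    boys-accept  : All (λ p → Maybe.All (proj₁ p ∈ˢ_) (lookup boyLists (proj₂ p))) pairs

encodeSubset : ∀ {n} → Subset n → Tree
encodeSubset s = encodeList encodeBool (toList s)

encodeMarriage : Marriage → Tree
encodeMarriage I =
  encodeList (encodeMaybe encodeSubset) (toList girlLists) ∙
  encodeList (encodeMaybe encodeSubset) (toList boyLists)
  where open Marriage I

SymmetricMarriage : Problem
SymmetricMarriage = record
  { Instance = Marriage
  ; encode   = encodeMarriage
  ; Promise  = λ _ → ⊤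
  ; Yes      = Solution
  }

{-# OPTIONS --safe #-}

module Submission where

-- At most one variable of each ⊕≤1 statement S is true, so a clause D ⊆ S
-- forces the true variable of S to lie in D: only "good" variables, lying in
-- every such D, can be true.  A clause that is contained in some ⊕≤1 statement
-- is then satisfiable as soon as it has a good variable, independently of the
-- rest.  The remaining clauses are pairwise disjoint, and the formula is
-- satisfiable iff their good variables contain a system of representatives
-- that takes at most one variable from each ⊕≤1 statement.  This is a bipartite
-- matching problem, solved by an auction: a pending clause bids on its cheapest
-- slot, which raises the price by one and evicts the previous bidder.  If a
-- matching exists, no price exceeds the number of slots plus one, which bounds
-- the number of bids.  Polynomial running time is established for a small
-- class of combinators (composition, pairing, branching, folds) compiled to
-- WHILE programs with two variables, one of which serves as a stack.

open import Defs
open import Data.Bool using (Bool; true; false; T; T?; not; _∧_; _∨_)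
  renaming (if_then_else_ to ifᵇ_then_else_; _≟_ to _≟ᵇ_)
open import Data.Empty using (⊥-elim)
open import Data.Fin using (zero; suc)
open import Data.List using (List; []; _∷_; _++_; _ʳ++_; cartesianProduct; concat; drop;
  filter; foldl; foldr; length; map; null; reverse)
open import Data.List.Properties
open import Data.List.Membership.Propositional using (_∈_; _∉_; find; lose)
open import Data.List.Membership.Propositional.Properties
import Data.List.Membership.DecPropositional as DecMembership
open import Data.List.Relation.Binary.Subset.Propositional using (_⊆_)
open import Data.List.Relation.Ternary.Interleaving using ([]; _∷ˡ_; _∷ʳ_)
open import Data.List.Relation.Ternary.Interleaving.Propositional using (Interleaving)
open import Data.List.Relation.Unary.All as All using (All; []; _∷_; all?)
import Data.List.Relation.Unary.All.Properties as All
open import Data.List.Relation.Unary.AllPairs as AllPairs using (AllPairs; []; _∷_)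
open import Data.List.Relation.Unary.Any as Any using (Any; here; there; any?)
open import Data.List.Relation.Unary.Unique.Propositional using (Unique)
import Data.List.Relation.Unary.Unique.Propositional.Properties as Unique
open import Data.Maybe using (just)
import Data.Maybe.Relation.Unary.Any as MaybeAny
open import Data.Nat using (ℕ; zero; suc; _+_; _*_; _≤_; _<_; z≤n; s≤s; _<?_; _<ᵇ_)
open import Data.Nat.ListAction using (sum)
open import Data.Nat.Properties
open import Data.Nat.Tactic.RingSolver using (solve-∀)
open import Data.Product using (Σ; ∃; ∃-syntax; _×_; _,_; proj₁; proj₂; uncurry)
open import Data.Sum using (_⊎_; inj₁; inj₂)
open import Data.Unit using (tt)
open import Data.Vec using ([]; _∷_)
open import Function.Bundles using (mk⇔)
open import Relation.Binary using (DecidableEquality)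
open import Relation.Binary.PropositionalEquality
open import Relation.Nullary using (¬_; Dec; does; proof; yes; no; ofʸ; ofⁿ; ¬?; _→-dec_; _×-dec_)
open import Relation.Nullary.Decidable using (isYes; fromWitness; map′)

-- Feasible functions

infixl 6 _⊕_
infixl 7 _⊛_

-- Polynomial expressions are monotone by construction and closed under substitution, so bounds
-- compose without expanding coefficients; `toPolynomial` converts them at the end.
data Bound : Set where
  con     : ℕ → Bound
  X       : Bound
  _⊕_ _⊛_ : Bound → Bound → Bound

infix 8 _at_

_at_ : Bound → ℕ → ℕ
con c   at n = c
X       at n = n
(b ⊕ c) at n = b at n + c at n
(b ⊛ c) at n = b at n * c at n

at-mono : ∀ b {m n} → m ≤ n → b at m ≤ b at n
at-mono (con c) m≤n = ≤-refl
at-mono X       m≤n = m≤n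
at-mono (b ⊕ c) m≤n = +-mono-≤ (at-mono b m≤n) (at-mono c m≤n)
at-mono (b ⊛ c) m≤n = *-mono-≤ (at-mono b m≤n) (at-mono c m≤n)

_⊙_ : Bound → Bound → Bound
con c   ⊙ d = con c
X       ⊙ d = d
(b ⊕ c) ⊙ d = (b ⊙ d) ⊕ (c ⊙ d)
(b ⊛ c) ⊙ d = (b ⊙ d) ⊛ (c ⊙ d)

at-⊙ : ∀ b d n → (b ⊙ d) at n ≡ b at (d at n)
at-⊙ (con c) d n = refl
at-⊙ X       d n = refl
at-⊙ (b ⊕ c) d n = cong₂ _+_ (at-⊙ b d n) (at-⊙ c d n)
at-⊙ (b ⊛ c) d n = cong₂ _*_ (at-⊙ b d n) (at-⊙ c d n)

addᴾ : Polynomial → Polynomial → Polynomial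
addᴾ []      q       = q
addᴾ p       []      = p
addᴾ (a ∷ p) (b ∷ q) = a + b ∷ addᴾ p q

addᴾ-correct : ∀ p q n → ⟦ addᴾ p q ⟧ n ≡ ⟦ p ⟧ n + ⟦ q ⟧ n
addᴾ-correct []      q       n = refl
addᴾ-correct (a ∷ p) []      n = sym (+-identityʳ _)
addᴾ-correct (a ∷ p) (b ∷ q) n
  rewrite addᴾ-correct p q n = rearrange a b n (⟦ p ⟧ n) (⟦ q ⟧ n)
  where
  rearrange : ∀ a b n p q → a + b + n * (p + q) ≡ a + n * p + (b + n * q)
  rearrange = solve-∀

scaleᴾ : ℕ → Polynomial → Polynomial
scaleᴾ c = map (c *_)

scaleᴾ-correct : ∀ c p n → ⟦ scaleᴾ c p ⟧ n ≡ c * ⟦ p ⟧ n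
scaleᴾ-correct c []      n = sym (*-zeroʳ c)
scaleᴾ-correct c (a ∷ p) n rewrite scaleᴾ-correct c p n = rearrange c a n (⟦ p ⟧ n)
  where
  rearrange : ∀ c a n p → c * a + n * (c * p) ≡ c * (a + n * p)
  rearrange = solve-∀

mulᴾ : Polynomial → Polynomial → Polynomial
mulᴾ []      q = []
mulᴾ (a ∷ p) q = addᴾ (scaleᴾ a q) (0 ∷ mulᴾ p q)

mulᴾ-correct : ∀ p q n → ⟦ mulᴾ p q ⟧ n ≡ ⟦ p ⟧ n * ⟦ q ⟧ n
mulᴾ-correct []      q n = refl
mulᴾ-correct (a ∷ p) q n
  rewrite addᴾ-correct (scaleᴾ a q) (0 ∷ mulᴾ p q) n
        | scaleᴾ-correct a q n | mulᴾ-correct p q n = rearrange a n (⟦ p ⟧ n) (⟦ q ⟧ n)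
  where
  rearrange : ∀ a n p q → a * q + n * (p * q) ≡ (a + n * p) * q
  rearrange = solve-∀

toPolynomial : Bound → Polynomial
toPolynomial (con c) = c ∷ []
toPolynomial X       = 0 ∷ 1 ∷ []
toPolynomial (b ⊕ c) = addᴾ (toPolynomial b) (toPolynomial c)
toPolynomial (b ⊛ c) = mulᴾ (toPolynomial b) (toPolynomial c)

toPolynomial-correct : ∀ b n → ⟦ toPolynomial b ⟧ n ≡ b at n
toPolynomial-correct (con c) n = rearrange c n
  where
  rearrange : ∀ c n → c + n * 0 ≡ c
  rearrange = solve-∀
toPolynomial-correct X n = rearrange n
  where
  rearrange : ∀ n → n * (1 + n * 0) ≡ n
  rearrange = solve-∀
toPolynomial-correct (b ⊕ c) n
  rewrite addᴾ-correct (toPolynomial b) (toPolynomial c) n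
        | toPolynomial-correct b n | toPolynomial-correct c n = refl
toPolynomial-correct (b ⊛ c) n
  rewrite mulᴾ-correct (toPolynomial b) (toPolynomial c) n
        | toPolynomial-correct b n | toPolynomial-correct c n = refl

-- Data types and their encodings as trees

infixr 6 _⊗_

data Ty : Set where
  tree bool : Ty
  list      : Ty → Ty
  _⊗_       : Ty → Ty → Ty

El : Ty → Set
El tree     = Tree
El bool     = Bool
El (list a) = List (El a)
El (a ⊗ b)  = El a × El b

enc : ∀ {a} → El a → Tree
enc {tree}   x       = x
enc {bool}   x       = encodeBool x
enc {list a} x       = encodeList enc x
enc {a ⊗ b}  (x , y) = enc x ∙ enc y

∣_∣ : ∀ {a} → El a → ℕ
∣ x ∣ = size (enc x)

pattern acc = zero
pattern stk = suc zero

-- The second variable is a stack, restored on exit.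

record Feasible {a b : Ty} (f : El a → El b) : Set where
  field
    code  : Command 2
    bound : Bound
    runs  : ∀ x s → ∃[ t ] (code ⊢ enc x ∷ s ∷ [] ⇓ enc (f x) ∷ s ∷ [] [ t ])
                         × t + ∣ f x ∣ ≤ bound at ∣ x ∣

  -- Running time alone does not limit the output, since sharing allows trees much larger than the
  -- time spent building them. `bound` therefore limits the sum of both, and this half controls the
  -- input of the next program in a composition.
  small : ∀ x → ∣ f x ∣ ≤ bound at ∣ x ∣
  small x = let t , _ , t≤ = runs x nil in ≤-trans (m≤n+m _ t) t≤

open Feasible

-- Composition, pairing and branching

private
  variable
    a b c : Ty

-- Used to pass from a fold or conditional built from the combinators to the pointwise equal library
-- function.
≗ᶠ : {f g : El a → El b} → (∀ x → f x ≡ g x) → Feasible f → Feasible g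
≗ᶠ f≗g F .code  = F .code
≗ᶠ f≗g F .bound = F .bound
≗ᶠ f≗g F .runs x s rewrite sym (f≗g x) = F .runs x s

exprᶠ : {f : El a → El b} (e : Expr 2) (B : Bound) →
        (∀ x s → eval e (enc x ∷ s ∷ []) ≡ enc (f x)) →
        (∀ x → ∣ f x ∣ ≤ B at ∣ x ∣) → Feasible f
exprᶠ e B eq f≤ .code  = acc := e
exprᶠ e B eq f≤ .bound = con (suc (cost e)) ⊕ B
exprᶠ e B eq f≤ .runs x s =
  _ , subst (λ y → acc := e ⊢ enc x ∷ s ∷ [] ⇓ y ∷ s ∷ [] [ _ ]) (eq x s) assign
    , +-monoʳ-≤ (suc (cost e)) (f≤ x)

idᶠ : Feasible {a} {a} (λ x → x)
idᶠ = exprᶠ (var acc) X (λ _ _ → refl) (λ _ → ≤-refl)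

fstᶠ : Feasible {a ⊗ b} {a} proj₁
fstᶠ = exprᶠ (hd (var acc)) X (λ _ _ → refl) (λ _ → m≤n⇒m≤1+n (m≤m+n _ _))

sndᶠ : Feasible {a ⊗ b} {b} proj₂
sndᶠ = exprᶠ (tl (var acc)) X (λ _ _ → refl) (λ (x , _) → m≤n⇒m≤1+n (m≤n+m _ ∣ x ∣))

quoteTree : ∀ {k} → Tree → Expr k
quoteTree nil     = nil
quoteTree (x ∙ y) = cons (quoteTree x) (quoteTree y)

eval-quoteTree : ∀ {k} x (σ : Store k) → eval (quoteTree x) σ ≡ x
eval-quoteTree nil     σ = refl
eval-quoteTree (x ∙ y) σ = cong₂ _∙_ (eval-quoteTree x σ) (eval-quoteTree y σ)

constᶠ : (y : El b) → Feasible {a} {b} (λ _ → y)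
constᶠ y = exprᶠ (quoteTree (enc y)) (con ∣ y ∣) (λ _ _ → eval-quoteTree _ _) (λ _ → ≤-refl)

infixr 9 _∘ᶠ_

_∘ᶠ_ : {f : El b → El c} {g : El a → El b} →
       Feasible f → Feasible g → Feasible (λ x → f (g x))
(F ∘ᶠ G) .code  = G .code ⨾ F .code
(F ∘ᶠ G) .bound = G .bound ⊕ (F .bound ⊙ G .bound)
_∘ᶠ_ {f = f} {g} F G .runs x s =
  let t , r , t≤ = G .runs x s
      u , q , u≤ = F .runs (g x) s
  in t + u , seq r q ,
     (begin
       t + u + ∣ f (g x) ∣                         ≡⟨ +-assoc t u _ ⟩
       t + (u + ∣ f (g x) ∣)                       ≤⟨ +-mono-≤ (≤-trans (m≤m+n t _) t≤) u≤ ⟩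
       G .bound at ∣ x ∣ + F .bound at ∣ g x ∣
         ≤⟨ +-monoʳ-≤ (G .bound at ∣ x ∣) (at-mono (F .bound) (small G x)) ⟩
       G .bound at ∣ x ∣ + F .bound at (G .bound at ∣ x ∣)
         ≡⟨ cong (G .bound at ∣ x ∣ +_) (at-⊙ (F .bound) (G .bound) ∣ x ∣) ⟨
       G .bound at ∣ x ∣ + (F .bound ⊙ G .bound) at ∣ x ∣ ∎)
  where open ≤-Reasoning

⟨_,_⟩ᶠ : {f : El a → El b} {g : El a → El c} →
         Feasible f → Feasible g → Feasible {a} {b ⊗ c} (λ x → f x , g x)
⟨ F , G ⟩ᶠ .code =
  -- The input is saved on the stack; the result of `F` is pushed next, the input is reloaded for
  -- `G`, and both entries are popped at the end.
  stk := cons (var acc) (var stk) ⨾ F .code ⨾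
  stk := cons (var acc) (var stk) ⨾ acc := hd (tl (var stk)) ⨾ G .code ⨾
  acc := cons (hd (var stk)) (var acc) ⨾ stk := tl (tl (var stk))
-- The five assignments take 21 units, and the pair node adds 1 to the output size.
⟨ F , G ⟩ᶠ .bound = con 22 ⊕ (F .bound ⊕ G .bound)
⟨_,_⟩ᶠ {f = f} {g} F G .runs x s =
  let t , r , t≤ = F .runs x (enc x ∙ s)
      u , q , u≤ = G .runs x (enc (f x) ∙ enc x ∙ s)
  in _ , seq assign (seq r (seq assign (seq assign (seq q (seq assign assign))))) ,
     ≤-trans (≤-reflexive (rearrange t u ∣ f x ∣ ∣ g x ∣)) (+-monoʳ-≤ 22 (+-mono-≤ t≤ u≤))
  where
  rearrange : ∀ t u m n → 4 + (t + (4 + (4 + (u + (5 + 4))))) + suc (m + n)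
            ≡ 22 + (t + m + (u + n))
  rearrange = solve-∀

-- A nonempty list is encoded as the pair of its head and its tail, so the pairing program serves
-- unchanged.
consᶠ : {f : El a → El b} {g : El a → List (El b)} →
        Feasible f → Feasible g → Feasible {a} {list b} (λ x → f x ∷ g x)
consᶠ F G = record { Feasible ⟨ F , G ⟩ᶠ }

ifᶠ : {p : El a → Bool} {f g : El a → El b} →
      Feasible p → Feasible f → Feasible g → Feasible (λ x → ifᵇ p x then f x else g x)
ifᶠ P F G .code =
  stk := cons (var acc) (var stk) ⨾ P .code ⨾
  stk := cons (var acc) (var stk) ⨾ acc := hd (tl (var stk)) ⨾
  if hd (var stk) then (stk := tl (tl (var stk)) ⨾ F .code)
                  else (stk := tl (tl (var stk)) ⨾ G .code)
-- `Bound` has no maximum; the sum of the bounds of both branches takes its place.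
ifᶠ P F G .bound = con 20 ⊕ (P .bound ⊕ (F .bound ⊕ G .bound))
ifᶠ {p = p} {f} {g} P F G .runs x s
  with p x | P .runs x (enc x ∙ s)
... | true | t , r , t≤ =
  let u , q , u≤ = F .runs x s
  in _ , seq assign (seq r (seq assign (seq assign (if-true (λ ()) (seq assign q))))) ,
     ≤-trans (m≤m+n _ 1) (≤-trans (≤-reflexive (rearrange t u ∣ f x ∣))
       (+-monoʳ-≤ 20 (+-mono-≤ (m+n≤o⇒m≤o t t≤)
         (≤-trans u≤ (m≤m+n _ (G .bound at ∣ x ∣))))))
  where
  rearrange : ∀ t u m → 4 + (t + (4 + (4 + suc (2 + (4 + u))))) + m + 1 ≡ 20 + (t + (u + m))
  rearrange = solve-∀
... | false | t , r , t≤ =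
  let u , q , u≤ = G .runs x s
  in _ , seq assign (seq r (seq assign (seq assign (if-false refl (seq assign q))))) ,
     ≤-trans (m≤m+n _ 1) (≤-trans (≤-reflexive (rearrange t u ∣ g x ∣))
       (+-monoʳ-≤ 20 (+-mono-≤ (m+n≤o⇒m≤o t t≤)
         (≤-trans u≤ (m≤n+m _ (F .bound at ∣ x ∣))))))
  where
  rearrange : ∀ t u m → 4 + (t + (4 + (4 + suc (2 + (4 + u))))) + m + 1 ≡ 20 + (t + (u + m))
  rearrange = solve-∀

caseList : ∀ {A B : Set} → B → (A → List A → B) → List A → B
caseList n c []       = n
caseList n c (x ∷ xs) = c x xs

-- A pair (x , y ∷ ys) and the triple (x , y , ys) have the same encoding.

caseᶠ : {xs : El a → List (El b)} {n : El a → El c} {k : El (a ⊗ b ⊗ list b) → El c} →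
        Feasible xs → Feasible n → Feasible k →
        Feasible (λ x → caseList (n x) (λ y ys → k (x , y , ys)) (xs x))
caseᶠ {a} {b} {c} {xs} {n} {k} L N K = branch ∘ᶠ ⟨ idᶠ , L ⟩ᶠ
  where
  branch : Feasible {a ⊗ list b} (λ (x , ys) → caseList (n x) (λ y ys → k (x , y , ys)) ys)
  branch .code = if tl (var acc) then K .code else (acc := hd (var acc) ⨾ N .code)
  branch .bound = con 6 ⊕ (K .bound ⊕ N .bound)
  branch .runs (x , []) s =
    let t , r , t≤ = N .runs x s
    in _ , if-false refl (seq assign r) ,
       +-monoʳ-≤ 6 (≤-trans t≤ (≤-trans (at-mono (N .bound) (m≤n⇒m≤1+n (m≤m+n _ _)))
                                         (m≤n+m _ _)))
  branch .runs (x , y ∷ ys) s =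
    let t , r , t≤ = K .runs (x , y , ys) s
    in _ , if-true (λ ()) r ,
       +-mono-≤ {3} {6} (s≤s (s≤s (s≤s z≤n)))
         (≤-trans t≤ (m≤m+n _ (N .bound at ∣ x , y ∷ ys ∣)))

-- Folds over lists

length≤size : (xs : List (El a)) → length xs ≤ ∣_∣ {list a} xs
length≤size []       = z≤n
length≤size (x ∷ xs) = s≤s (≤-trans (length≤size xs) (m≤n+m _ ∣ x ∣))

module Loop {f : El (a ⊗ b ⊗ c) → El c} (F : Feasible {a ⊗ b ⊗ c} f) where

  loop : Command 2
  loop =
    while hd (tl (var acc)) loop
      -- The environment, the remaining list and the accumulator are saved on the stack while `F`
      -- runs on the environment, the head of the list and the accumulator.
      ( stk := cons (var acc) (var stk)
      ⨾ acc := cons (hd (var acc)) (cons (hd (hd (tl (var acc)))) (tl (tl (var acc))))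
      ⨾ F .code
      ⨾ acc := cons (hd (hd (var stk))) (cons (tl (hd (tl (hd (var stk))))) (var acc))
      ⨾ stk := tl (var stk))

  -- A feasible body alone would not do, since it could double the accumulator in each round; hence
  -- `M` limits the accumulator after every prefix. Apart from the body, a round takes 4 units for
  -- the test and 31 for four assignments; the failing last test takes 4.
  loop-runs : ∀ x ys z s {L M} → ∣_∣ {list b} ys ≤ L →
    (∀ us vs → ys ≡ us ++ vs → ∣ foldl (λ z y → f (x , y , z)) z us ∣ ≤ M) →
    ∃[ t ] (loop ⊢ (enc x ∙ enc {list b} ys ∙ enc z) ∷ s ∷ []
              ⇓ (enc x ∙ nil ∙ enc (foldl (λ z y → f (x , y , z)) z ys)) ∷ s ∷ [] [ t ])
         × t ≤ 4 + length ys * (35 + F .bound at (2 + (∣ x ∣ + (L + M))))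
  loop-runs x [] z s ys≤ z≤ = _ , while-false refl , ≤-refl
  loop-runs x (y ∷ ys) z s {L} {M} ys≤ z≤ =
    let t , r , t≤ = F .runs (x , y , z) ((enc x ∙ enc {list b} (y ∷ ys) ∙ enc z) ∙ s)
        u , q , u≤ = loop-runs x ys (f (x , y , z)) s
                       (≤-trans (m≤n⇒m≤1+n (m≤n+m _ ∣ y ∣)) ys≤)
                       (λ us vs eq → z≤ (y ∷ us) vs (cong (y ∷_) eq))
        K = F .bound at (2 + (∣ x ∣ + (L + M)))
        t≤K : t ≤ K
        t≤K = ≤-trans (m+n≤o⇒m≤o t t≤) (at-mono (F .bound) (begin
                suc (∣ x ∣ + suc (∣ y ∣ + ∣ z ∣)) ≡⟨ cong suc (+-suc ∣ x ∣ _) ⟩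
                2 + (∣ x ∣ + (∣ y ∣ + ∣ z ∣))
                  ≤⟨ +-monoʳ-≤ 2 (+-monoʳ-≤ ∣ x ∣ (+-mono-≤
                       (≤-trans (m≤n⇒m≤1+n (m≤m+n _ _)) ys≤) (z≤ [] (y ∷ ys) refl))) ⟩
                2 + (∣ x ∣ + (L + M)) ∎))
    in _ , while-true (λ ()) (seq assign (seq assign (seq r (seq assign assign)))) q ,
       (begin
         4 + (4 + (12 + (t + (12 + 3))) + u)   ≡⟨ rearrange t u ⟩
         (35 + t) + u                          ≤⟨ +-mono-≤ (+-monoʳ-≤ 35 t≤K) u≤ ⟩
         (35 + K) + (4 + length ys * (35 + K)) ≡⟨ rearrange′ (35 + K) (length ys * (35 + K)) ⟩
         4 + ((35 + K) + length ys * (35 + K)) ∎)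
    where
    open ≤-Reasoning
    rearrange : ∀ t u → 4 + (4 + (12 + (t + (12 + 3))) + u) ≡ (35 + t) + u
    rearrange = solve-∀
    rearrange′ : ∀ m n → m + (4 + n) ≡ 4 + (m + n)
    rearrange′ = solve-∀

foldlᶠ : {f : El (a ⊗ b ⊗ c) → El c} {z : El a → El c} {xs : El a → List (El b)} →
         (B : Bound) →
         (∀ x us vs → xs x ≡ us ++ vs → ∣ foldl (λ z y → f (x , y , z)) (z x) us ∣ ≤ B at ∣ x ∣) →
         Feasible {a ⊗ b ⊗ c} f → Feasible z → Feasible {a} {list b} xs →
         Feasible (λ x → foldl (λ z y → f (x , y , z)) (z x) (xs x))
foldlᶠ {a} {b} {c} {f} {z} {xs} B small≤ F Z L = record
  { code  = start .code ⨾ loop ⨾ acc := tl (tl (var acc))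
  ; bound = start .bound ⊕
            -- 4 units for the failing last test and 4 for extracting the accumulator.
            (con 8 ⊕ (L .bound ⊛ (con 35 ⊕ (F .bound ⊙ (con 2 ⊕ (X ⊕ (L .bound ⊕ B))))) ⊕ B))
  ; runs  = λ x s →
      let t , r , t≤ = start .runs x s
          u , q , u≤ = loop-runs x (xs x) (z x) s (small L x) (small≤ x)
          K = F .bound at (2 + (∣ x ∣ + (L .bound at ∣ x ∣ + B at ∣ x ∣)))
          K′ = (F .bound ⊙ (con 2 ⊕ (X ⊕ (L .bound ⊕ B)))) at ∣ x ∣
          w = foldl (λ z y → f (x , y , z)) (z x) (xs x)
      in _ , seq r (seq q assign) ,
         (begin
           t + (u + 4) + ∣ w ∣
             ≤⟨ +-mono-≤ (+-mono-≤ (m+n≤o⇒m≤o t t≤) (+-monoˡ-≤ 4 u≤))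
                         (small≤ x (xs x) [] (sym (++-identityʳ _))) ⟩
           start .bound at ∣ x ∣ + (4 + length (xs x) * (35 + K) + 4) + B at ∣ x ∣
             ≤⟨ +-monoˡ-≤ (B at ∣ x ∣) (+-monoʳ-≤ (start .bound at ∣ x ∣)
                  (+-monoˡ-≤ 4 (+-monoʳ-≤ 4 (*-monoˡ-≤ (35 + K)
                    (≤-trans (length≤size (xs x)) (small L x)))))) ⟩
           start .bound at ∣ x ∣ + (4 + L .bound at ∣ x ∣ * (35 + K) + 4) + B at ∣ x ∣
             ≡⟨ cong (λ k → start .bound at ∣ x ∣ + (4 + L .bound at ∣ x ∣ * (35 + k) + 4)
                              + B at ∣ x ∣) (at-⊙ (F .bound) _ ∣ x ∣) ⟨
           start .bound at ∣ x ∣ + (4 + L .bound at ∣ x ∣ * (35 + K′) + 4) + B at ∣ x ∣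
             ≡⟨ rearrange (start .bound at ∣ x ∣) (L .bound at ∣ x ∣ * (35 + K′)) (B at ∣ x ∣) ⟩
           start .bound at ∣ x ∣ + (8 + (L .bound at ∣ x ∣ * (35 + K′) + B at ∣ x ∣)) ∎)
  }
  where
  open Loop {a} {b} {c} F
  open ≤-Reasoning hiding (start)
  start : Feasible {a} {a ⊗ list b ⊗ c} (λ x → x , xs x , z x)
  start = ⟨ idᶠ , ⟨ L , Z ⟩ᶠ ⟩ᶠ
  rearrange : ∀ m n k → m + (4 + n + 4) + k ≡ m + (8 + (n + k))
  rearrange = solve-∀

-- Concatenation drops the final `nil` of `xs`, whence the `suc`.
∣∣-++ : (xs ys : List (El a)) → suc (∣_∣ {list a} (xs ++ ys)) ≡ ∣_∣ {list a} xs + ∣_∣ {list a} ys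
∣∣-++ []       ys = refl
∣∣-++ {a} (x ∷ xs) ys rewrite +-assoc ∣ x ∣ (∣_∣ {list a} xs) (∣_∣ {list a} ys)
  | sym (∣∣-++ {a} xs ys) = cong suc (sym (+-suc ∣ x ∣ _))

∣∣-++ˡ : (xs ys : List (El a)) → ∣_∣ {list a} xs ≤ ∣_∣ {list a} (xs ++ ys)
∣∣-++ˡ {a} []       ys = size>0 (enc {list a} ys)
  where
  size>0 : ∀ t → 1 ≤ size t
  size>0 nil     = ≤-refl
  size>0 (_ ∙ _) = s≤s z≤n
∣∣-++ˡ {a} (x ∷ xs) ys = s≤s (+-monoʳ-≤ ∣ x ∣ (∣∣-++ˡ {a} xs ys))

∣∣-++ʳ : (xs ys : List (El a)) → ∣_∣ {list a} ys ≤ ∣_∣ {list a} (xs ++ ys)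
∣∣-++ʳ []       ys = ≤-refl
∣∣-++ʳ {a} (x ∷ xs) ys = m≤n⇒m≤1+n (≤-trans (∣∣-++ʳ {a} xs ys) (m≤n+m _ ∣ x ∣))

∣∣-ʳ++ : (xs ys : List (El a)) →
         suc (∣_∣ {list a} (xs ʳ++ ys)) ≡ ∣_∣ {list a} xs + ∣_∣ {list a} ys
∣∣-ʳ++ []       ys = refl
∣∣-ʳ++ {a} (x ∷ xs) ys = trans (∣∣-ʳ++ {a} xs (x ∷ ys))
  (rearrange ∣ x ∣ (∣_∣ {list a} xs) (∣_∣ {list a} ys))
  where
  rearrange : ∀ k m n → m + suc (k + n) ≡ suc (k + m + n)
  rearrange = solve-∀

∣∣-reverse : (xs : List (El a)) → ∣_∣ {list a} (reverse xs) ≡ ∣_∣ {list a} xs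
∣∣-reverse {a} xs = suc-injective (trans (∣∣-ʳ++ {a} xs []) (+-comm _ 1))

reverseᶠ : {xs : El a → List (El b)} → Feasible {a} {list b} xs →
           Feasible {a} {list b} (λ x → reverse (xs x))
reverseᶠ {a} {b} L = foldlᶠ (L .bound)
  (λ x us vs eq → begin
    ∣_∣ {list b} (reverse us)  ≡⟨ ∣∣-reverse {b} us ⟩
    ∣_∣ {list b} us            ≤⟨ ∣∣-++ˡ {b} us vs ⟩
    ∣_∣ {list b} (us ++ vs)    ≡⟨ cong (∣_∣ {list b}) eq ⟨
    _                          ≤⟨ small L x ⟩
    _                          ∎)
  (consᶠ (fstᶠ ∘ᶠ sndᶠ) (sndᶠ ∘ᶠ sndᶠ)) (constᶠ []) L
  where open ≤-Reasoning

-- Runs the left fold on the reversed list, so the size condition concerns suffixes instead of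
-- prefixes.
foldrᶠ : {f : El (a ⊗ b ⊗ c) → El c} {z : El a → El c} {xs : El a → List (El b)} →
         (B : Bound) →
         (∀ x us vs → xs x ≡ us ++ vs → ∣ foldr (λ y z → f (x , y , z)) (z x) vs ∣ ≤ B at ∣ x ∣) →
         Feasible {a ⊗ b ⊗ c} f → Feasible z → Feasible {a} {list b} xs →
         Feasible (λ x → foldr (λ y z → f (x , y , z)) (z x) (xs x))
foldrᶠ {f = f} {z} {xs} B small≤ F Z L =
  ≗ᶠ (λ x → reverse-foldl (λ z y → f (x , y , z)) (z x) (xs x))
    (foldlᶠ B
      (λ x us vs eq → subst (λ w → ∣ w ∣ ≤ B at ∣ x ∣)
        (trans (sym (reverse-foldl (λ z y → f (x , y , z)) (z x) (reverse us)))
               (cong (foldl _ (z x)) (reverse-involutive us)))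
        (small≤ x (reverse vs) (reverse us)
          (trans (sym (reverse-involutive (xs x)))
                 (trans (cong reverse eq) (reverse-++ us vs)))))
      F Z (reverseᶠ L))

-- If a step enlarges the accumulator by an amount that does not depend on the accumulator, the
-- total growth is at most the length of the list times that amount. This local condition replaces a
-- bound on all intermediate values.
foldr⁺ᶠ : {f : El (a ⊗ b ⊗ c) → El c} {z : El a → El c} {xs : El a → List (El b)} →
          (P : Bound) →
          (∀ x y z → ∣ f (x , y , z) ∣ ≤ ∣ z ∣ + P at (∣ x ∣ + ∣ y ∣)) →
          Feasible {a ⊗ b ⊗ c} f → Feasible z → Feasible {a} {list b} xs →
          Feasible (λ x → foldr (λ y z → f (x , y , z)) (z x) (xs x))
foldr⁺ᶠ {a} {b} {c} {f} {z} {xs} P f≤ F Z L =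
  foldrᶠ (Z .bound ⊕ (L .bound ⊛ (P ⊙ (X ⊕ L .bound)))) small≤ F Z L
  where
  open ≤-Reasoning
  grow : ∀ x {l} vs → ∣_∣ {list b} vs ≤ l →
         ∣ foldr (λ y z → f (x , y , z)) (z x) vs ∣ ≤ ∣ z x ∣ + length vs * P at (∣ x ∣ + l)
  grow x []       vs≤ = m≤m+n _ 0
  grow x {l} (y ∷ vs) vs≤ = begin
    _ ≤⟨ f≤ x y _ ⟩
    _ ≤⟨ +-mono-≤ (grow x vs (≤-trans (m≤n⇒m≤1+n (m≤n+m _ ∣ y ∣)) vs≤))
                  (at-mono P (+-monoʳ-≤ ∣ x ∣ (≤-trans (m≤n⇒m≤1+n (m≤m+n _ _)) vs≤))) ⟩
    ∣ z x ∣ + length vs * K + K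
      ≡⟨ trans (+-assoc ∣ z x ∣ _ K) (cong (∣ z x ∣ +_) (+-comm _ K)) ⟩
    ∣ z x ∣ + (K + length vs * K) ∎
    where K = P at (∣ x ∣ + l)
  small≤ : ∀ x us vs → xs x ≡ us ++ vs → _
  small≤ x us vs eq = begin
    _ ≤⟨ grow x vs vs≤ ⟩
    ∣ z x ∣ + length vs * P at (∣ x ∣ + L .bound at ∣ x ∣)
      ≤⟨ +-mono-≤ (small Z x) (*-monoˡ-≤ _ (≤-trans (length≤size vs) vs≤)) ⟩
    Z .bound at ∣ x ∣ + L .bound at ∣ x ∣ * P at (∣ x ∣ + L .bound at ∣ x ∣)
      ≡⟨ cong (λ k → Z .bound at ∣ x ∣ + L .bound at ∣ x ∣ * k) (at-⊙ P _ ∣ x ∣) ⟨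
    _ ∎
    where
    vs≤ : ∣_∣ {list b} vs ≤ L .bound at ∣ x ∣
    vs≤ = begin
      _                       ≤⟨ ∣∣-++ʳ {b} us vs ⟩
      ∣_∣ {list b} (us ++ vs) ≡⟨ cong (∣_∣ {list b}) eq ⟨
      _                       ≤⟨ small L x ⟩
      _                       ∎

-- Boolean connectives and list operations

∣bool∣≤3 : (x : Bool) → ∣ x ∣ ≤ 3
∣bool∣≤3 false = s≤s z≤n
∣bool∣≤3 true  = ≤-refl

notᶠ : {p : El a → Bool} → Feasible p → Feasible (λ x → not (p x))
notᶠ {p = p} P = ≗ᶠ (λ x → lemma (p x)) (ifᶠ P (constᶠ false) (constᶠ true))
  where
  lemma : ∀ x → (ifᵇ x then false else true) ≡ not x
  lemma false = refl
  lemma true  = refl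

infixr 6 _∧ᶠ_
infixr 5 _∨ᶠ_

_∧ᶠ_ : {p q : El a → Bool} → Feasible p → Feasible q → Feasible (λ x → p x ∧ q x)
_∧ᶠ_ {p = p} {q} P Q = ≗ᶠ (λ x → lemma (p x) (q x)) (ifᶠ P Q (constᶠ false))
  where
  lemma : ∀ x y → (ifᵇ x then y else false) ≡ x ∧ y
  lemma false y = refl
  lemma true  y = refl

_∨ᶠ_ : {p q : El a → Bool} → Feasible p → Feasible q → Feasible (λ x → p x ∨ q x)
_∨ᶠ_ {p = p} {q} P Q = ≗ᶠ (λ x → lemma (p x) (q x)) (ifᶠ P (constᶠ true) Q)
  where
  lemma : ∀ x y → (ifᵇ x then true else y) ≡ x ∨ y
  lemma false y = refl
  lemma true  y = refl

nullᶠ : {xs : El a → List (El b)} → Feasible {a} {list b} xs → Feasible (λ x → null (xs x))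
nullᶠ {xs = xs} L = ≗ᶠ (λ x → lemma (xs x)) (caseᶠ L (constᶠ true) (constᶠ false))
  where
  lemma : ∀ {A : Set} (xs : List A) → caseList true (λ _ _ → false) xs ≡ null xs
  lemma []      = refl
  lemma (_ ∷ _) = refl

envᶠ : Feasible {a ⊗ b ⊗ c} {a} (λ (x , _ , _) → x)
envᶠ = fstᶠ

eltᶠ : Feasible {a ⊗ b ⊗ c} {b} (λ (_ , y , _) → y)
eltᶠ = fstᶠ ∘ᶠ sndᶠ

accᶠ : Feasible {a ⊗ b ⊗ c} {c} (λ (_ , _ , z) → z)
accᶠ = sndᶠ ∘ᶠ sndᶠ

mapᶠ : {f : El (a ⊗ b) → El c} {xs : El a → List (El b)} →
       Feasible {a ⊗ b} f → Feasible {a} {list b} xs →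
       Feasible {a} {list c} (λ x → map (λ y → f (x , y)) (xs x))
mapᶠ {a} {b} {c} {f} {xs} F L =
  ≗ᶠ (λ x → sym (map-is-foldr (xs x)))
    (foldr⁺ᶠ {c = list c} (con 1 ⊕ (F .bound ⊙ (con 1 ⊕ X)))
      (λ x y z → begin
        suc (∣ f (x , y) ∣ + ∣_∣ {list c} z)
          ≡⟨ trans (cong suc (+-comm ∣ f (x , y) ∣ _)) (sym (+-suc _ _)) ⟩
        ∣_∣ {list c} z + suc ∣ f (x , y) ∣
          ≤⟨ +-monoʳ-≤ (∣_∣ {list c} z) (s≤s (small F (x , y))) ⟩
        ∣_∣ {list c} z + suc (F .bound at (suc (∣ x ∣ + ∣ y ∣)))
          ≡⟨ cong (λ k → ∣_∣ {list c} z + suc k) (at-⊙ (F .bound) _ (∣ x ∣ + ∣ y ∣)) ⟨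
        _ ∎)
      (consᶠ (F ∘ᶠ ⟨ envᶠ , eltᶠ ⟩ᶠ) accᶠ) (constᶠ []) L)
  where open ≤-Reasoning

module _ {P : El a → El b → Set} (P? : ∀ x y → Dec (P x y)) {xs : El a → List (El b)}
         (F : Feasible {a ⊗ b} {bool} (λ (x , y) → does (P? x y)))
         (L : Feasible {a} {list b} xs) where

  filterᶠ : Feasible {a} {list b} (λ x → filter (P? x) (xs x))
  filterᶠ = ≗ᶠ (λ x → lemma x (xs x))
    (foldr⁺ᶠ {c = list b} (con 1 ⊕ X) small≤
      (ifᶠ (F ∘ᶠ ⟨ envᶠ , eltᶠ ⟩ᶠ) (consᶠ eltᶠ accᶠ) accᶠ) (constᶠ []) L)
    where
    lemma : ∀ x ys → foldr (λ y z → ifᵇ does (P? x y) then y ∷ z else z) [] ys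
                     ≡ filter (P? x) ys
    lemma x []       = refl
    lemma x (y ∷ ys) with does (P? x y)
    ... | false = lemma x ys
    ... | true  = cong (y ∷_) (lemma x ys)
    small≤ : ∀ x y (z : List (El b)) →
             ∣_∣ {list b} (ifᵇ does (P? x y) then y ∷ z else z)
             ≤ ∣_∣ {list b} z + (1 + (∣ x ∣ + ∣ y ∣))
    small≤ x y z with does (P? x y)
    ... | false = m≤m+n _ _
    ... | true  = ≤-trans (m≤m+n _ ∣ x ∣) (≤-reflexive (rearrange ∣ x ∣ ∣ y ∣ (∣_∣ {list b} z)))
      where
      rearrange : ∀ m n k → suc (n + k) + m ≡ k + (1 + (m + n))
      rearrange = solve-∀

  anyᶠ : Feasible (λ x → does (any? (P? x) (xs x)))
  anyᶠ = ≗ᶠ (λ x → lemma x (xs x))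
    (foldr⁺ᶠ (con 3) (λ x y z → ≤-trans (∣bool∣≤3 (does (P? x y) ∨ z)) (m≤n+m 3 ∣ z ∣))
      ((F ∘ᶠ ⟨ envᶠ , eltᶠ ⟩ᶠ) ∨ᶠ accᶠ) (constᶠ false) L)
    where
    lemma : ∀ x ys → foldr (λ y z → does (P? x y) ∨ z) false ys ≡ does (any? (P? x) ys)
    lemma x []       = refl
    lemma x (y ∷ ys) = cong (does (P? x y) ∨_) (lemma x ys)

  allᶠ : Feasible (λ x → does (all? (P? x) (xs x)))
  allᶠ = ≗ᶠ (λ x → lemma x (xs x))
    (foldr⁺ᶠ (con 3) (λ x y z → ≤-trans (∣bool∣≤3 (does (P? x y) ∧ z)) (m≤n+m 3 ∣ z ∣))
      ((F ∘ᶠ ⟨ envᶠ , eltᶠ ⟩ᶠ) ∧ᶠ accᶠ) (constᶠ true) L)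
    where
    lemma : ∀ x ys → foldr (λ y z → does (P? x y) ∧ z) true ys ≡ does (all? (P? x) ys)
    lemma x []       = refl
    lemma x (y ∷ ys) = cong (does (P? x y) ∧_) (lemma x ys)

infixr 5 _++ᶠ_

_++ᶠ_ : {xs ys : El a → List (El b)} → Feasible {a} {list b} xs → Feasible {a} {list b} ys →
        Feasible {a} {list b} (λ x → xs x ++ ys x)
_++ᶠ_ {b = b} {xs} {ys} L M = ≗ᶠ (λ x → sym (++-is-foldr (xs x) (ys x)))
  (foldr⁺ᶠ {c = list b} (con 1 ⊕ X)
    (λ x y z → ≤-trans (m≤m+n _ ∣ x ∣) (≤-reflexive (rearrange ∣ x ∣ ∣ y ∣ (∣_∣ {list b} z))))
    (consᶠ eltᶠ accᶠ) M L)
  where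
  rearrange : ∀ m n k → suc (n + k) + m ≡ k + (1 + (m + n))
  rearrange = solve-∀

concatᶠ : {xss : El a → List (List (El b))} → Feasible {a} {list (list b)} xss →
          Feasible {a} {list b} (λ x → concat (xss x))
concatᶠ {a} {b} = foldr⁺ᶠ {c = list b} X
  (λ x y z → begin
    ∣_∣ {list b} (y ++ z)                            ≤⟨ n≤1+n _ ⟩
    suc (∣_∣ {list b} (y ++ z))                      ≡⟨ ∣∣-++ {b} y z ⟩
    ∣_∣ {list b} y + ∣_∣ {list b} z                  ≡⟨ +-comm (∣_∣ {list b} y) _ ⟩
    ∣_∣ {list b} z + ∣_∣ {list b} y                  ≤⟨ +-monoʳ-≤ (∣_∣ {list b} z) (m≤n+m _ ∣ x ∣) ⟩
    ∣_∣ {list b} z + (∣ x ∣ + ∣_∣ {list b} y)        ∎)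
  (eltᶠ ++ᶠ accᶠ) (constᶠ [])
  where open ≤-Reasoning

-- One element of `ys x` is dropped for each element of `xs x`; something is left over iff `xs x` is
-- shorter.
shorterᶠ : {xs : El a → List (El b)} {ys : El a → List (El c)} →
           Feasible {a} {list b} xs → Feasible {a} {list c} ys →
           Feasible (λ x → does (length (xs x) <? length (ys x)))
shorterᶠ {a} {b} {c} {xs} {ys} L M = ≗ᶠ (λ x → lemma (xs x) (ys x))
  (notᶠ (nullᶠ (foldr⁺ᶠ {c = list c} (con 0) (λ x y z → small≤ z)
    (≗ᶠ (λ (x , y , z) → tail-drop z) (caseᶠ {b = c} accᶠ (constᶠ []) accᶠ)) M L)))
  where
  tail-drop : ∀ {A : Set} (zs : List A) → caseList [] (λ _ zs → zs) zs ≡ drop 1 zs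
  tail-drop []       = refl
  tail-drop (_ ∷ zs) = refl
  small≤ : ∀ z {n} → ∣_∣ {list c} (drop 1 z) ≤ ∣_∣ {list c} z + n
  small≤ []      = m≤m+n 1 _
  small≤ (x ∷ z) = ≤-trans (m≤n⇒m≤1+n (m≤n+m _ ∣ x ∣)) (m≤m+n _ _)
  dropLast : ∀ {A B : Set} (x : A) (xs : List A) (ys : List B) →
    drop 1 (foldr (λ _ → drop 1) ys xs) ≡ foldr (λ _ → drop 1) (drop 1 ys) xs
  dropLast x []       ys = refl
  dropLast x (_ ∷ xs) ys = cong (drop 1) (dropLast x xs ys)
  lemma : ∀ {A B : Set} (xs : List A) (ys : List B) →
    not (null (foldr (λ _ → drop 1) ys xs)) ≡ (length xs <ᵇ length ys)
  lemma []       []       = refl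
  lemma []       (_ ∷ _)  = refl
  lemma (x ∷ xs) []       = trans (cong (λ z → not (null z)) (dropLast x xs [])) (lemma xs [])
  lemma (x ∷ xs) (y ∷ ys) = trans (cong (λ z → not (null z)) (dropLast x xs (y ∷ ys))) (lemma xs ys)

-- Equality of words

word : Ty
word = list bool

_≟ʷ_ : DecidableEquality Variable
_≟ʷ_ = ≡-dec _≟ᵇ_

open DecMembership _≟ʷ_ using (_∈?_)

-- Without a primitive equality test, words are compared bit by bit. The state is a flag for
-- agreement so far and the rest of the second word; running out of that rest clears the flag.
matchStep : Bool → Bool × List Bool → Bool × List Bool
matchStep y (ok , zs) = caseList (false , []) (λ z zs → ok ∧ does (y ≟ᵇ z) , zs) zs

equalsᶠ : {xs ys : El a → Variable} → Feasible {a} {word} xs → Feasible {a} {word} ys →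
          Feasible (λ x → does (xs x ≟ʷ ys x))
equalsᶠ {a} {xs} {ys} L M = ≗ᶠ (λ x → lemma (xs x) (ys x))
  (finish ∘ᶠ foldr⁺ᶠ {c = bool ⊗ word} (con 3) (λ x y z → small≤ y z)
    (caseᶠ (sndᶠ ∘ᶠ accᶠ) (constᶠ (false , []))
      ⟨ fstᶠ ∘ᶠ accᶠ ∘ᶠ fstᶠ ∧ᶠ sameBit ∘ᶠ ⟨ eltᶠ ∘ᶠ fstᶠ , eltᶠ ⟩ᶠ , accᶠ ⟩ᶠ)
    -- Reversing the first word makes the right fold read it from the front.
    ⟨ constᶠ true , M ⟩ᶠ (reverseᶠ L))
  where
  finish : Feasible {bool ⊗ word} {bool} (λ (ok , zs) → ok ∧ null zs)
  finish = fstᶠ ∧ᶠ nullᶠ sndᶠ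
  sameBit : Feasible {bool ⊗ bool} {bool} (λ (x , y) → does (x ≟ᵇ y))
  sameBit = ≗ᶠ (λ { (false , false) → refl ; (false , true) → refl
                  ; (true  , false) → refl ; (true  , true) → refl })
               (ifᶠ fstᶠ sndᶠ (notᶠ sndᶠ))
  small≤ : ∀ y (z : El (bool ⊗ word)) →
           ∣_∣ {bool ⊗ word} (matchStep y z) ≤ ∣_∣ {bool ⊗ word} z + 3
  small≤ y (ok , [])     = m≤n+m 3 (∣_∣ {bool ⊗ word} (ok , []))
  small≤ y (ok , z ∷ zs) = ≤-trans (s≤s (+-monoˡ-≤ (∣_∣ {word} zs) (∣bool∣≤3 (ok ∧ does (y ≟ᵇ z)))))
    (≤-trans (m≤m+n _ (1 + (∣ ok ∣ + ∣ z ∣))) (≤-reflexive (rearrange ∣ ok ∣ ∣ z ∣ (∣_∣ {word} zs))))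
    where
    rearrange : ∀ m n k → suc (3 + k) + (1 + (m + n)) ≡ suc (m + suc (n + k)) + 3
    rearrange = solve-∀
  match : Bool → List Bool → List Bool → Bool
  match ok xs ys = uncurry (λ ok zs → ok ∧ null zs)
    (foldl (λ s x → matchStep x s) (ok , ys) xs)
  match-false : ∀ xs ys → match false xs ys ≡ false
  match-false []       ys       = refl
  match-false (x ∷ xs) []       = match-false xs []
  match-false (x ∷ xs) (y ∷ ys) = match-false xs ys
  match-true : ∀ xs ys → match true xs ys ≡ does (xs ≟ʷ ys)
  match-true []       []       = refl
  match-true []       (_ ∷ _)  = refl
  match-true (x ∷ xs) []       = match-false xs []
  match-true (x ∷ xs) (y ∷ ys) with does (x ≟ᵇ y)
  ... | false = match-false xs ys
  ... | true  = match-true xs ys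
  lemma : ∀ xs ys → uncurry (λ ok zs → ok ∧ null zs)
            (foldr matchStep (true , ys) (reverse xs)) ≡ does (xs ≟ʷ ys)
  lemma xs ys = trans (cong (uncurry (λ ok zs → ok ∧ null zs))
                            (reverse-foldr matchStep (true , ys) xs))
                      (match-true xs ys)

memberᶠ : {x : El a → Variable} {xs : El a → List Variable} →
          Feasible {a} {word} x → Feasible {a} {list word} xs →
          Feasible (λ e → does (x e ∈? xs e))
memberᶠ {x = x} E L = anyᶠ (λ e y → x e ≟ʷ y) (equalsᶠ (E ∘ᶠ fstᶠ) sndᶠ) L

-- Auctions

-- A demand is a clause together with the slots it may be served by; the
-- clause only keeps demands with the same slots apart.

demand bid state : Ty
demand = list word ⊗ list word
bid    = word ⊗ demand
state  = list demand ⊗ list bid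

Demand Bid State : Set
Demand = El demand
Bid    = El bid
State  = El state

slots : Demand → List Variable
slots = proj₂

-- The log of all bids, latest first, encodes the auction: the price of a slot
-- is the number of bids on it, and its holder is the latest bidder.

bids : Variable → List Bid → List Bid
bids w = filter (λ b → proj₁ b ≟ʷ w)

opaque
  price : Variable → List Bid → ℕ
  price w log = length (bids w log)

cheapest : List Bid → Variable → List Variable → Variable
cheapest log = foldr (λ v u → ifᵇ does (price v log <? price u log) then v else u)

place : Demand → Variable → List Demand → List Bid → State
place d v Q log = caseList Q (λ b _ → proj₂ b ∷ Q) (bids v log) , (v , d) ∷ log

-- A demand without slots can never be served: once at the head of the queue it blocks the auction,
-- and the queue stays nonempty.
step : State → State
step (Q , log) =
  caseList (Q , log) (λ d Q′ →
    caseList (Q , log) (λ w ws → place d (cheapest log w ws) Q′ log) (slots d)) Q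

allSlots : List Demand → List Variable
allSlots ds = concat (map slots ds)

-- Only the length matters, as the list serves as a loop counter. For n slots counted with
-- repetition it is (n + 1)², more than the n (n + 1) bids that the price bound allows.
rounds : List Demand → List (Variable × Variable)
rounds ds = cartesianProduct ([] ∷ allSlots ds) ([] ∷ allSlots ds)

run : List Demand → List (Variable × Variable) → State
run ds = foldr (λ _ → step) (ds , [])

auction : List Demand → State
auction ds = run ds (rounds ds)

-- Feasibility of the auction steps

bidsᶠ : {w : El a → Variable} {log : El a → List Bid} →
        Feasible {a} {word} w → Feasible {a} {list bid} log →
        Feasible {a} {list bid} (λ x → bids (w x) (log x))
bidsᶠ {w = w} W L = filterᶠ (λ x b → proj₁ b ≟ʷ w x) (equalsᶠ (fstᶠ ∘ᶠ sndᶠ) (W ∘ᶠ fstᶠ)) L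

opaque
  unfolding price

  cheaperᶠ : {log : El a → List Bid} {v u : El a → Variable} →
             Feasible {a} {list bid} log → Feasible {a} {word} v → Feasible {a} {word} u →
             Feasible (λ x → does (price (v x) (log x) <? price (u x) (log x)))
  cheaperᶠ L V U = shorterᶠ {b = bid} {c = bid} (bidsᶠ V L) (bidsᶠ U L)

cheapestᶠ : {log : El a → List Bid} {w : El a → Variable} {ws : El a → List Variable} →
            Feasible {a} {list bid} log → Feasible {a} {word} w → Feasible {a} {list word} ws →
            Feasible {a} {word} (λ x → cheapest (log x) (w x) (ws x))
cheapestᶠ {log = log} L W Ws =
  foldr⁺ᶠ {c = word} X (λ x v u → small≤ x v u)
    (ifᶠ (cheaperᶠ (L ∘ᶠ envᶠ) eltᶠ accᶠ) eltᶠ accᶠ)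
    W Ws
  where
  small≤ : ∀ x v u → ∣_∣ {word} (ifᵇ does (price v (log x) <? price u (log x)) then v else u)
                     ≤ ∣_∣ {word} u + (∣ x ∣ + ∣_∣ {word} v)
  small≤ x v u with does (price v (log x) <? price u (log x))
  ... | false = m≤m+n _ _
  ... | true  = ≤-trans (m≤n+m _ ∣ x ∣) (m≤n+m _ (∣_∣ {word} u))

placeᶠ : Feasible {demand ⊗ word ⊗ list demand ⊗ list bid} {state}
           (λ (d , v , Q , log) → place d v Q log)
placeᶠ = ⟨ caseᶠ {b = bid} {c = list demand} (bidsᶠ eltᶠ (sndᶠ ∘ᶠ accᶠ)) (fstᶠ ∘ᶠ accᶠ)
             (consᶠ {b = demand} (sndᶠ ∘ᶠ eltᶠ) (fstᶠ ∘ᶠ accᶠ ∘ᶠ fstᶠ))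
         , consᶠ {b = bid} ⟨ eltᶠ , fstᶠ ⟩ᶠ (sndᶠ ∘ᶠ accᶠ) ⟩ᶠ

stepᶠ : Feasible {state} {state} step
stepᶠ =
  caseᶠ {b = demand} fstᶠ idᶠ
    (caseᶠ {b = word} (sndᶠ ∘ᶠ eltᶠ) fstᶠ
      (placeᶠ ∘ᶠ ⟨ eltᶠ ∘ᶠ fstᶠ
                , ⟨ cheapestᶠ (sndᶠ ∘ᶠ fstᶠ ∘ᶠ fstᶠ) eltᶠ accᶠ
                  , ⟨ accᶠ ∘ᶠ fstᶠ , sndᶠ ∘ᶠ fstᶠ ∘ᶠ fstᶠ ⟩ᶠ ⟩ᶠ ⟩ᶠ))

roundsᶠ : Feasible {list demand} {list (word ⊗ word)} rounds
roundsᶠ = ≗ᶠ (λ ds → lemma ([] ∷ allSlots ds) ([] ∷ allSlots ds))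
  (concatᶠ {b = word ⊗ word} (mapᶠ {b = word} {c = list (word ⊗ word)}
    (mapᶠ {b = word} {c = word ⊗ word} ⟨ sndᶠ ∘ᶠ fstᶠ , sndᶠ ⟩ᶠ (padded ∘ᶠ fstᶠ)) padded))
  where
  padded : Feasible {list demand} {list word} (λ ds → [] ∷ allSlots ds)
  padded = consᶠ {b = word} (constᶠ [])
    (concatᶠ {b = word} (mapᶠ {b = demand} {c = list word} (sndᶠ ∘ᶠ sndᶠ) idᶠ))
  lemma : ∀ {A B : Set} (xs : List A) (ys : List B) →
          concat (map (λ x → map (x ,_) ys) xs) ≡ cartesianProduct xs ys
  lemma []       ys = refl
  lemma (x ∷ xs) ys = cong (map (x ,_) ys ++_) (lemma xs ys)

-- The cheapest slot

cheapest-∈ : ∀ log w ws → cheapest log w ws ∈ w ∷ ws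
cheapest-∈ log w []       = here refl
cheapest-∈ log w (v ∷ ws)
  with does (price v log <? price (cheapest log w ws) log) | cheapest-∈ log w ws
... | true  | _       = there (here refl)
... | false | here p  = here p
... | false | there p = there (there p)

cheapest-≤ : ∀ log w ws {z} → z ∈ w ∷ ws → price (cheapest log w ws) log ≤ price z log
cheapest-≤ log w []       (here refl) = ≤-refl
cheapest-≤ log w (v ∷ ws) {z} = λ
  { (here refl)         → ≤-trans (proj₂ choose) (cheapest-≤ log w ws (here refl))
  ; (there (here refl)) → proj₁ choose
  ; (there (there z∈))  → ≤-trans (proj₂ choose) (cheapest-≤ log w ws (there z∈)) }
  where
  choice : ∀ {u} (v<?u : Dec (price v log < price u log)) →
           let z = ifᵇ does v<?u then v else u in
           price z log ≤ price v log × price z log ≤ price u log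
  choice (yes v<u) = ≤-refl , <⇒≤ v<u
  choice (no v≮u)  = ≮⇒≥ v≮u , ≤-refl
  choose = choice (price v log <? price (cheapest log w ws) log)

-- Size of the auction state

∈⇒∣∣≤ : {x : El a} {xs : List (El a)} → x ∈ xs → ∣ x ∣ ≤ ∣_∣ {list a} xs
∈⇒∣∣≤         (here refl)          = m≤n⇒m≤1+n (m≤m+n _ _)
∈⇒∣∣≤ {a} {xs = y ∷ xs} (there x∈) = m≤n⇒m≤1+n (≤-trans (∈⇒∣∣≤ {a} x∈) (m≤n+m _ ∣ y ∣))

all⇒∣∣≤ : ∀ {m} {xs : List (El a)} → All (λ x → ∣ x ∣ ≤ m) xs →
          ∣_∣ {list a} xs ≤ suc (length xs * suc m)
all⇒∣∣≤ []               = ≤-refl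
all⇒∣∣≤ {a} {m} (x≤ ∷ xs≤) = s≤s (≤-trans (+-mono-≤ x≤ (all⇒∣∣≤ {a} xs≤)) (≤-reflexive (+-suc m _)))

-- A step copies demands already in the state, so its growth is not bounded independently of the
-- state and `foldr⁺ᶠ` does not apply. But all copies stem from the input: with n the input size,
-- after k steps demands and words still have size at most n, and only their number has grown.
record Small (n k : ℕ) (s : State) : Set where
  constructor small-state
  field
    queue-length : length (proj₁ s) ≤ n + k
    queue-small  : All (λ d → ∣_∣ {demand} d ≤ n) (proj₁ s)
    log-length   : length (proj₂ s) ≤ k
    log-small    : All (λ b → ∣_∣ {word} (proj₁ b) ≤ n × ∣_∣ {demand} (proj₂ b) ≤ n) (proj₂ s)

step-small : ∀ {n k} s → Small n k s → Small n (suc k) (step s)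
step-small {n} {k} ([] , log) (small-state _ Q∣ log≤ log∣) =
  small-state z≤n [] (m≤n⇒m≤1+n log≤) log∣
step-small {n} {k} ((c , []) ∷ Q , log) (small-state Q≤ Q∣ log≤ log∣) =
  small-state (≤-trans Q≤ (+-monoʳ-≤ n (n≤1+n k))) Q∣ (m≤n⇒m≤1+n log≤) log∣
step-small {n} {k} ((c , w ∷ ws) ∷ Q , log) (small-state Q≤ (d∣ ∷ Q∣) log≤ log∣)
  with bids (cheapest log w ws) log
     | All.filter⁺ (λ b → proj₁ b ≟ʷ cheapest log w ws) log∣
... | []          | _              =
  small-state (≤-trans (<⇒≤ Q≤) (+-monoʳ-≤ n (n≤1+n k))) Q∣ (s≤s log≤) ((v≤ , d∣) ∷ log∣)
  where v≤ = ≤-trans (∈⇒∣∣≤ {word} (cheapest-∈ log w ws))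
                     (≤-trans (m≤n⇒m≤1+n (m≤n+m _ (∣_∣ {list word} c))) d∣)
... | (_ , d′) ∷ _ | (_ , d′∣) ∷ _ =
  small-state (≤-trans Q≤ (+-monoʳ-≤ n (n≤1+n k))) (d′∣ ∷ Q∣) (s≤s log≤) ((v≤ , d∣) ∷ log∣)
  where v≤ = ≤-trans (∈⇒∣∣≤ {word} (cheapest-∈ log w ws))
                     (≤-trans (m≤n⇒m≤1+n (m≤n+m _ (∣_∣ {list word} c))) d∣)

run-small : ∀ ds zs → Small (∣_∣ {list demand} ds) (length zs) (run ds zs)
run-small ds []       = small-state (≤-trans (length≤size {demand} ds) (m≤m+n _ 0))
                                    (All.tabulate (∈⇒∣∣≤ {demand})) z≤n []
run-small ds (_ ∷ zs) = step-small _ (run-small ds zs)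

small⇒∣∣≤ : ∀ {n k} s → Small n k s →
            ∣_∣ {state} s ≤ 3 + ((n + k) * (1 + n) + k * (2 + (n + n)))
small⇒∣∣≤ {n} {k} (Q , log) (small-state Q≤ Q∣ log≤ log∣) = begin
  suc (∣_∣ {list demand} Q + ∣_∣ {list bid} log)
    ≤⟨ s≤s (+-mono-≤ (all⇒∣∣≤ {demand} Q∣)
                     (all⇒∣∣≤ {bid} (All.map (λ (w∣ , d∣) → s≤s (+-mono-≤ w∣ d∣)) log∣))) ⟩
  suc (suc (length Q * suc n) + suc (length log * (2 + (n + n))))
    ≤⟨ s≤s (+-mono-≤ (s≤s (*-monoˡ-≤ (suc n) Q≤)) (s≤s (*-monoˡ-≤ (2 + (n + n)) log≤))) ⟩
  suc (suc ((n + k) * suc n) + suc (k * (2 + (n + n))))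
    ≡⟨ cong (λ m → suc (suc m)) (+-suc _ _) ⟩
  _ ∎
  where open ≤-Reasoning

auction-via : Feasible {list demand} {list (word ⊗ word)} rounds →
              Feasible {list demand} {state} auction
auction-via R =
  foldrᶠ {c = state}
    (con 3 ⊕ ((X ⊕ R .bound) ⊛ (con 1 ⊕ X) ⊕ R .bound ⊛ (con 2 ⊕ (X ⊕ X))))
    small≤ (stepᶠ ∘ᶠ accᶠ) ⟨ idᶠ , constᶠ [] ⟩ᶠ R
  where
  open ≤-Reasoning
  small≤ : ∀ ds us vs → rounds ds ≡ us ++ vs → _
  small≤ ds us vs eq = ≤-trans (small⇒∣∣≤ (run ds vs) (run-small ds vs))
    (+-monoʳ-≤ 3 (+-mono-≤ (*-monoˡ-≤ (suc n) (+-monoʳ-≤ n vs≤)) (*-monoˡ-≤ (2 + (n + n)) vs≤)))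
    where
    n = ∣_∣ {list demand} ds
    vs≤ : length vs ≤ R .bound at n
    vs≤ = begin
      length vs                                 ≤⟨ length≤size {word ⊗ word} vs ⟩
      ∣_∣ {list (word ⊗ word)} vs               ≤⟨ ∣∣-++ʳ {word ⊗ word} us vs ⟩
      ∣_∣ {list (word ⊗ word)} (us ++ vs)       ≡⟨ cong (∣_∣ {list (word ⊗ word)}) eq ⟨
      ∣_∣ {list (word ⊗ word)} (rounds ds)      ≤⟨ small R ds ⟩
      _ ∎

auctionᶠ : Feasible {list demand} {state} auction
auctionᶠ = auction-via roundsᶠ

-- Counting and choosing in duplicate-free lists

unique-⊆⇒length≤ : ∀ {A : Set} {xs ys : List A} → Unique xs → xs ⊆ ys → length xs ≤ length ys
unique-⊆⇒length≤ []              xs⊆ys = z≤n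
unique-⊆⇒length≤ {xs = x ∷ xs} (x∉xs ∷ xs!) xs⊆ys
  with ls , rs , refl ← ∈-∃++ (xs⊆ys (here refl)) =
  subst (suc (length xs) ≤_) (sym (length-++-sucʳ ls x rs))
    (s≤s (unique-⊆⇒length≤ xs! λ z∈xs → drop-mid (xs⊆ys (there z∈xs)) (All.lookup x∉xs z∈xs)))
  where
  drop-mid : ∀ {z} → z ∈ ls ++ x ∷ rs → x ≢ z → z ∈ ls ++ rs
  drop-mid z∈ x≢z with ∈-++⁻ ls z∈
  ... | inj₁ z∈ls         = ∈-++⁺ˡ z∈ls
  ... | inj₂ (here refl)  = ⊥-elim (x≢z refl)
  ... | inj₂ (there z∈rs) = ∈-++⁺ʳ ls z∈rs

-- Collects one R-successor of each entry; injectivity up to `f` keeps them apart. `f` is the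
-- identity when chains of slots are extended and `rep A` when a model is built.
image : ∀ {A B C : Set} {R : A → B → Set} (f : B → C) →
        (∀ {x x′ y y′} → R x y → R x′ y′ → f y ≡ f y′ → x ≡ x′) →
        ∀ {xs} → Unique xs → All (λ x → ∃ (R x)) xs →
        ∃[ ys ] length ys ≡ length xs
              × AllPairs (λ y y′ → f y ≢ f y′) ys
              × All (λ y → ∃[ x ] x ∈ xs × R x y) ys
              × All (λ x → Any (R x) ys) xs
image f inj []           []               = [] , refl , [] , [] , []
image f inj (x∉ ∷ xs!) ((y , Rxy) ∷ Rxs)
  with ys , len , ys! , from , to ← image f inj xs! Rxs =
  y ∷ ys , cong suc len ,
  All.map (λ (x′ , x′∈ , Rx′y′) eq → All.lookup x∉ x′∈ (inj Rxy Rx′y′ eq)) from ∷ ys! ,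
  (_ , here refl , Rxy) ∷ All.map (λ (x′ , x′∈ , R′) → x′ , there x′∈ , R′) from ,
  here Rxy ∷ All.map there to

-- Slot holders and the invariant of the auction

record Holds (w : Variable) (d : Demand) (log : List Bid) : Set where
  constructor holds
  field
    {slot}   : Variable
    {rest}   : List Bid
    latest   : bids w log ≡ (slot , d) ∷ rest

holds-functional : ∀ {w d d′} log → Holds w d log → Holds w d′ log → d ≡ d′
holds-functional log (holds p) (holds q) with trans (sym p) q
... | refl = refl

module _ {v : Variable} {d₀ : Demand} {log : List Bid} where

  bids-accept : bids v ((v , d₀) ∷ log) ≡ (v , d₀) ∷ bids v log
  bids-accept = filter-accept (λ b → proj₁ b ≟ʷ v) refl

  bids-reject : ∀ {w} → w ≢ v → bids w ((v , d₀) ∷ log) ≡ bids w log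
  bids-reject {w} w≢v = filter-reject (λ b → proj₁ b ≟ʷ w) (λ eq → w≢v (sym eq))

  holds-bidder : Holds v d₀ ((v , d₀) ∷ log)
  holds-bidder = holds bids-accept

  holds-other : ∀ {w d} → w ≢ v → Holds w d log → Holds w d ((v , d₀) ∷ log)
  holds-other w≢v (holds eq) = holds (trans (bids-reject w≢v) eq)

  holds-∷⁻ : ∀ {w d} → Holds w d ((v , d₀) ∷ log) →
             (w ≡ v × d ≡ d₀) ⊎ (w ≢ v × Holds w d log)
  holds-∷⁻ {w} (holds eq) with w ≟ʷ v
  ... | yes refl with refl ← trans (sym bids-accept) eq = inj₁ (refl , refl)
  ... | no w≢v   = inj₂ (w≢v , holds (trans (sym (bids-reject w≢v)) eq))

  opaque
    unfolding price

    price-bid : price v ((v , d₀) ∷ log) ≡ suc (price v log)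
    price-bid = cong length bids-accept

    price-other : ∀ {w} → w ≢ v → price w ((v , d₀) ∷ log) ≡ price w log
    price-other w≢v = cong length (bids-reject w≢v)

  price-mono : ∀ w → price w log ≤ price w ((v , d₀) ∷ log)
  price-mono w with w ≟ʷ v
  ... | yes refl = ≤-trans (n≤1+n _) (≤-reflexive (sym price-bid))
  ... | no w≢v   = ≤-reflexive (sym (price-other w≢v))

opaque
  unfolding price

  price-[] : ∀ w → price w [] ≡ 0
  price-[] w = refl

  price>0⇒held : ∀ {w} log → 1 ≤ price w log → ∃[ d ] Holds w d log
  price>0⇒held {w} log 1≤ with bids w log in eq
  ... | (_ , d) ∷ _ = d , holds eq

-- The field `near` is ε-complementary slackness: a holder has overpaid by at
-- most one unit.

record Fair (ds : List Demand) (s : State) : Set where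
  queue = proj₁ s
  log   = proj₂ s
  field
    holds-injective : ∀ {w w′ d} → Holds w d log → Holds w′ d log → w ≡ w′
    pending         : ∀ {w d} → d ∈ queue → ¬ Holds w d log
    queue-unique    : Unique queue
    covered         : ∀ {d} → d ∈ ds → d ∈ queue ⊎ ∃[ w ] Holds w d log
    queued          : ∀ {d} → d ∈ queue → d ∈ ds
    logged          : All (λ (w , d) → d ∈ ds × w ∈ slots d) log
    near            : ∀ {w d z} → Holds w d log → z ∈ slots d →
                      price w log ≤ suc (price z log)

  holder : ∀ {w d} → Holds w d log → d ∈ ds × w ∈ slots d
  holder {w} {d} (holds {w′} eq)
    with b∈ , refl ← ∈-filter⁻ (λ b → proj₁ b ≟ʷ w) {xs = log}
                       (subst ((w′ , d) ∈_) (sym eq) (here refl)) =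
    All.lookup logged b∈

module _ {ds : List Demand} {d₀ : Demand} {Q : List Demand} {log : List Bid}
         (fair : Fair ds (d₀ ∷ Q , log)) where

  open Fair fair hiding (log)

  module _ {v : Variable} (v∈d₀ : v ∈ slots d₀)
           (v≤ : ∀ {z : Variable} → z ∈ slots d₀ → price v log ≤ price z log) where

    private
      log′ = (v , d₀) ∷ log

    d₀∉Q : d₀ ∉ Q
    d₀∉Q d₀∈Q with d₀∉ ∷ _ ← queue-unique = All.lookup d₀∉ d₀∈Q refl

    inj′ : ∀ {w w′ d} → Holds w d log′ → Holds w′ d log′ → w ≡ w′
    inj′ h h′ with holds-∷⁻ h | holds-∷⁻ h′
    ... | inj₁ (refl , _)    | inj₁ (refl , _)    = refl
    ... | inj₁ (_ , refl)    | inj₂ (_ , h₂)      = ⊥-elim (pending (here refl) h₂)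
    ... | inj₂ (_ , h₁)      | inj₁ (_ , refl)    = ⊥-elim (pending (here refl) h₁)
    ... | inj₂ (_ , h₁)      | inj₂ (_ , h₂)      = holds-injective h₁ h₂

    pending′ : ∀ {w d} → d ∈ Q → ¬ Holds w d log′
    pending′ d∈Q h with holds-∷⁻ h
    ... | inj₁ (_ , refl) = d₀∉Q d∈Q
    ... | inj₂ (_ , h₁)   = pending (there d∈Q) h₁

    -- The slot of the new bidder was cheapest before its price rose by one. For any other holder
    -- the price of the held slot is unchanged, while prices elsewhere can only rise.
    near′ : ∀ {w d z} → Holds w d log′ → z ∈ slots d → price w log′ ≤ suc (price z log′)
    near′ {z = z} h z∈d with holds-∷⁻ h
    ... | inj₁ (refl , refl) = ≤-trans (≤-reflexive price-bid)
                                 (s≤s (≤-trans (v≤ z∈d) (price-mono z)))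
    ... | inj₂ (w≢v , h₁)    = ≤-trans (≤-reflexive (price-other w≢v))
                                 (≤-trans (near h₁ z∈d) (s≤s (price-mono z)))

    logged′ : All (λ (w , d) → d ∈ ds × w ∈ slots d) log′
    logged′ = (queued (here refl) , v∈d₀) ∷ logged

    -- The list of earlier bids on `v` is generalised so that it can be matched: it is empty if the
    -- slot was free, and otherwise its head names the evicted holder.
    evict-fair : ∀ bs → bids v log ≡ bs →
                 Fair ds (caseList Q (λ b _ → proj₂ b ∷ Q) bs , log′)
    evict-fair [] eq = record
      { holds-injective = inj′
      ; pending         = pending′
      ; queue-unique    = AllPairs.tail queue-unique
      ; covered         = cover
      ; queued          = λ d∈Q → queued (there d∈Q)
      ; logged          = logged′
      ; near            = near′
      }
      where
      cover : ∀ {d} → d ∈ ds → d ∈ Q ⊎ ∃[ w ] Holds w d log′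
      cover d∈ds with covered d∈ds
      ... | inj₁ (here refl)  = inj₂ (v , holds-bidder)
      ... | inj₁ (there d∈Q)  = inj₁ d∈Q
      ... | inj₂ (w , h@(holds eq′)) with w ≟ʷ v
      ...   | no w≢v   = inj₂ (w , holds-other w≢v h)
      ...   | yes refl with () ← trans (sym eq) eq′
    evict-fair ((v′ , d₁) ∷ rest) eq = record
      { holds-injective = inj′
      ; pending         = λ { (here refl) → evicted ; (there d∈Q) → pending′ d∈Q }
      ; queue-unique    = All.tabulate (λ { d∈Q refl → pending (there d∈Q) held })
                          ∷ AllPairs.tail queue-unique
      ; covered         = cover
      ; queued          = λ { (here refl) → proj₁ (holder held) ; (there d∈Q) → queued (there d∈Q) }
      ; logged          = logged′
      ; near            = near′
      }
      where
      held : Holds v d₁ log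
      held = holds eq
      evicted : ∀ {w} → ¬ Holds w d₁ log′
      evicted h with holds-∷⁻ h
      ... | inj₁ (_ , refl)  = pending (here refl) held
      ... | inj₂ (w≢v , h₁)  = w≢v (holds-injective h₁ held)
      cover : ∀ {d} → d ∈ ds → d ∈ d₁ ∷ Q ⊎ ∃[ w ] Holds w d log′
      cover d∈ds with covered d∈ds
      ... | inj₁ (here refl)  = inj₂ (v , holds-bidder)
      ... | inj₁ (there d∈Q)  = inj₁ (there d∈Q)
      ... | inj₂ (w , h) with w ≟ʷ v
      ...   | no w≢v   = inj₂ (w , holds-other w≢v h)
      ...   | yes refl = inj₁ (here (holds-functional log h held))

    place-fair : Fair ds (place d₀ v Q log)
    place-fair = evict-fair (bids v log) refl

step-fair : ∀ {ds} s → Fair ds s → Fair ds (step s)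
step-fair ([] , log)                 fair = fair
step-fair ((c , []) ∷ Q , log)       fair = fair
step-fair ((c , w ∷ ws) ∷ Q , log) fair =
  place-fair fair (cheapest-∈ log w ws) (cheapest-≤ log w ws)

run-fair : ∀ {ds} → Unique ds → ∀ zs → Fair ds (run ds zs)
run-fair ds! [] = record
  { holds-injective = λ ()
  ; pending         = λ _ ()
  ; queue-unique    = ds!
  ; covered         = inj₁
  ; queued          = λ d∈ → d∈
  ; logged          = []
  ; near            = λ ()
  }
run-fair ds! (_ ∷ zs) = step-fair _ (run-fair ds! zs)

-- A system of distinct representatives. It is a relation, since a demand may have several: one for
-- each true variable when it comes from a model.
record Represents (R : Demand → Variable → Set) (ds : List Demand) : Set where
  field
    represented : ∀ {d} → d ∈ ds → ∃[ w ] w ∈ slots d × R d w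
    distinct    : ∀ {d d′ w} → d ∈ ds → d′ ∈ ds → R d w → R d′ w → d ≡ d′

-- By `covered`, a demand that is not queued holds a slot, and no slot has two holders.
auction-sound : ∀ {ds} → Unique ds → proj₁ (auction ds) ≡ [] →
                Represents (λ d w → Holds w d (proj₂ (auction ds))) ds
auction-sound {ds} ds! Q≡[] = record
  { represented = represented
  ; distinct    = λ _ _ → holds-functional (proj₂ (auction ds))
  }
  where
  open Fair (run-fair ds! (rounds ds))
  represented : ∀ {d} → d ∈ ds → _
  represented d∈ds with covered d∈ds
  ... | inj₁ d∈Q with () ← subst (_ ∈_) Q≡[] d∈Q
  ... | inj₂ (w , h) = w , proj₂ (holder h) , h

-- Completeness of the auction

module _ {ds : List Demand} {R : Demand → Variable → Set} (represents : Represents R ds) where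

  open Represents represents

  private
    U = allSlots ds

  slot∈U : ∀ {d w} → d ∈ ds → w ∈ slots d → w ∈ U
  slot∈U d∈ds w∈d = ∈-concat⁺′ w∈d (∈-map⁺ slots d∈ds)

  module _ {d₀ : Demand} {Q : List Demand} {log : List Bid} (fair : Fair ds (d₀ ∷ Q , log)) {p : ℕ}
           (p≤ : ∀ {z : Variable} → z ∈ slots d₀ → p ≤ price z log) where

    open Fair fair hiding (log)

    -- A step along an alternating path: from a slot to its holder in the auction, and on to a slot
    -- representing this holder.
    Next : Variable → Variable → Set
    Next w z = ∃[ d ] d ∈ ds × Holds w d log × z ∈ slots d × R d z

    next-injective : ∀ {w w′ z z′} → Next w z → Next w′ z′ → z ≡ z′ → w ≡ w′
    next-injective (d , d∈ , h , _ , Rz) (d′ , d′∈ , h′ , _ , Rz′) refl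
      with refl ← distinct d∈ d′∈ Rz Rz′ = holds-injective h h′

    next : ∀ {w} → 1 ≤ price w log → ∃ (Next w)
    next 1≤ with d , h ← price>0⇒held log 1≤
      with z , z∈d , Rdz ← represented (proj₁ (holder h)) =
      z , d , proj₁ (holder h) , h , z∈d , Rdz

    representative≢next : ∀ {w z₀ z} → R d₀ z₀ → Next w z → z₀ ≢ z
    representative≢next Rz₀ (d , d∈ , h , _ , Rz) refl
      with refl ← distinct (queued (here refl)) d∈ Rz₀ Rz = pending (here refl) h

    -- The slot representing d₀ costs at least p.  Representing in turn the
    -- holders of the slots found so far yields one slot more, at prices lower
    -- by at most one: d₀ itself holds nothing.
    chain : ∀ j → suc j ≤ p →
            ∃[ ws ] length ws ≡ suc j × Unique ws
                  × All (λ w → p ≤ j + price w log × ∃[ d ] d ∈ ds × w ∈ slots d × R d w) ws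
    chain zero _ with w , w∈d₀ , Rdw ← represented (queued (here refl)) =
      w ∷ [] , refl , [] ∷ [] , (p≤ w∈d₀ , d₀ , queued (here refl) , w∈d₀ , Rdw) ∷ []
    chain (suc j) j<p
      with ws , len , ws! , ws✓ ← chain j (<⇒≤ j<p)
      with z₀ , z₀∈d₀ , Rz₀ ← represented (queued (here refl))
      -- From p at most j plus the price and j < p, the price is positive, so the slot has a holder.
      with zs , len′ , zs! , from , _ ← image {R = Next} (λ z → z) next-injective ws!
             (All.map (λ (p≤w , _) → next (+-cancelˡ-≤ j _ _
               (≤-trans (≤-reflexive (+-comm j 1)) (≤-trans (<⇒≤ j<p) p≤w)))) ws✓)
      = z₀ ∷ zs , cong suc (trans len′ len)
      , All.map (λ (_ , _ , w⟶z) → representative≢next Rz₀ w⟶z) from ∷ zs!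
      , (≤-trans (p≤ z₀∈d₀) (m≤n+m _ (suc j)) , d₀ , queued (here refl) , z₀∈d₀ , Rz₀)
        ∷ All.map (λ (w , w∈ , d , d∈ , h , z∈d , Rz) →
            ≤-trans (proj₁ (All.lookup ws✓ w∈))
              (≤-trans (+-monoʳ-≤ j (near h z∈d)) (≤-reflexive (+-suc j _)))
            , d , d∈ , z∈d , Rz) from

    -- If all slots of a pending demand cost at least p, the chain provides p distinct slots, all of
    -- them in `U`.
    bid≤slots : p ≤ length U
    bid≤slots = at-most p ≤-refl
      where
      at-most : ∀ q → q ≤ p → q ≤ length U
      at-most zero    _   = z≤n
      at-most (suc j) j<p with ws , len , ws! , ws✓ ← chain j j<p =
        subst (_≤ length U) len (unique-⊆⇒length≤ ws! λ w∈ →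
          let _ , _ , d∈ , w∈d , _ = All.lookup ws✓ w∈ in slot∈U d∈ w∈d)

  -- A bid is placed only on a slot of price at most `length U`, which it raises by one.
  Affordable : List Bid → Set
  Affordable log = ∀ w → price w log ≤ suc (length U)

  -- While a demand is pending, every step adds a bid: a demand with a representative has some slot,
  -- so the auction cannot block.
  step-progress : ∀ {n} s → Fair ds s → Affordable (proj₂ s) →
                  proj₁ s ≡ [] ⊎ length (proj₂ s) ≡ n →
                  Affordable (proj₂ (step s)) ×
                  (proj₁ (step s) ≡ [] ⊎ length (proj₂ (step s)) ≡ suc n)
  step-progress ([] , log)             fair aff _           = aff , inj₁ refl
  step-progress ((c , []) ∷ Q , log) fair aff _
    with () ← proj₁ (proj₂ (represented (Fair.queued fair (here refl))))
  step-progress ((c , w ∷ ws) ∷ Q , log) fair aff (inj₂ len) = aff′ , inj₂ (cong suc len)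
    where
    v = cheapest log w ws
    aff′ : Affordable ((v , c , w ∷ ws) ∷ log)
    aff′ u with u ≟ʷ v
    ... | yes refl = ≤-trans (≤-reflexive price-bid) (s≤s (bid≤slots fair (cheapest-≤ log w ws)))
    ... | no u≢v   = ≤-trans (≤-reflexive (price-other u≢v)) (aff u)

  run-progress : Unique ds → ∀ zs → let Q , log = run ds zs in
                 Affordable log × (Q ≡ [] ⊎ length log ≡ length zs)
  run-progress ds! []       = (λ w → ≤-trans (≤-reflexive (price-[] w)) z≤n) , inj₂ refl
  run-progress ds! (_ ∷ zs) with aff , dec ← run-progress ds! zs =
    step-progress (run ds zs) (run-fair ds! zs) aff dec

  -- Counting bids

  total : List Variable → List Bid → ℕ
  total ws log = sum (map (λ w → price w log) ws)

  total-mono : ∀ ws {b log} → total ws log ≤ total ws (b ∷ log)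
  total-mono []       = z≤n
  total-mono (w ∷ ws) = +-mono-≤ (price-mono w) (total-mono ws)

  -- An inequality, because `ws` may contain the slot several times and each occurrence counts.
  total-bid : ∀ {w ws d log} → w ∈ ws → suc (total ws log) ≤ total ws ((w , d) ∷ log)
  total-bid {w} {_ ∷ ws} (here refl) =
    +-mono-≤ (≤-reflexive (sym price-bid)) (total-mono ws)
  total-bid {ws = u ∷ ws} {log = log} (there w∈) =
    ≤-trans (≤-reflexive (sym (+-suc (price u log) _))) (+-mono-≤ (price-mono u) (total-bid w∈))

  length≤total : ∀ {ws log} → All (λ b → proj₁ b ∈ ws) log → length log ≤ total ws log
  length≤total []         = z≤n
  length≤total (b∈ ∷ log∈) = ≤-trans (s≤s (length≤total log∈)) (total-bid b∈)

  total≤ : ∀ ws {log m} → (∀ w → price w log ≤ m) → total ws log ≤ length ws * m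
  total≤ []       price≤ = z≤n
  total≤ (w ∷ ws) price≤ = +-mono-≤ (price≤ w) (total≤ ws price≤)

  length-rounds : length (rounds ds) ≡ suc (length U) * suc (length U)
  length-rounds = lemma ([] ∷ U) ([] ∷ U)
    where
    lemma : ∀ {A B : Set} (xs : List A) (ys : List B) →
            length (cartesianProduct xs ys) ≡ length xs * length ys
    lemma []       ys = refl
    lemma (x ∷ xs) ys = trans (length-++ (map (x ,_) ys))
      (cong₂ _+_ (length-map (x ,_) ys) (lemma xs ys))

  -- Otherwise every round has added a bid, which makes (n + 1)² bids for n = `length U`; but n
  -- slots of price at most n + 1 account for at most n (n + 1).
  auction-complete : Unique ds → proj₁ (auction ds) ≡ []
  auction-complete ds! with run-progress ds! (rounds ds)
  ... | aff , inj₁ Q≡[] = Q≡[]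
  ... | aff , inj₂ len  = ⊥-elim (<-irrefl refl (begin-strict
    length (proj₂ (auction ds))            ≤⟨ length≤total (All.map (uncurry slot∈U) logged) ⟩
    total U (proj₂ (auction ds))           ≤⟨ total≤ U aff ⟩
    length U * suc (length U)              <⟨ s≤s (m≤n+m _ (length U)) ⟩
    suc (length U) * suc (length U)        ≡⟨ length-rounds ⟨
    length (rounds ds)                     ≡⟨ len ⟨
    length (proj₂ (auction ds))            ∎))
    where
    open ≤-Reasoning
    open Fair (run-fair ds! (rounds ds)) using (logged)

-- The decision procedure

Clause : Set
Clause = List Variable

Good : List Clause → List Clause → Variable → Set
Good A C x = All (λ S → x ∈ S → All (λ D → All (_∈ S) D → x ∈ D) C) A

Local : List Clause → Clause → Set
Local A c = Any (λ S → All (_∈ S) c) A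

contained? : ∀ D S → Dec (All (_∈ S) D)
contained? D S = all? (_∈? S) D

good? : ∀ A C x → Dec (Good A C x)
good? A C x = all? (λ S → (x ∈? S) →-dec all? (λ D → contained? D S →-dec (x ∈? D)) C) A

local? : ∀ A c → Dec (Local A c)
local? A c = any? (contained? c) A

-- The division into two groups is not part of the encoded formula. These clauses can be computed
-- and stand in for the first group.
nonlocal : List Clause → List Clause → List Clause
nonlocal A = filter (λ c → ¬? (local? A c))

-- Variables of one `⊕≤1` statement compete for a single slot, named by the head of the statement;
-- any other variable is a slot of its own.
rep : List Clause → Variable → Variable
rep A x = foldr (λ S r → ifᵇ does (x ∈? S) then caseList r (λ h _ → h) S else r) x A

demandOf : List Clause → List Clause → Clause → Demand
demandOf A C c = c , map (rep A) (filter (good? A C) c)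

demands : List Clause → List Clause → List Demand
demands A C = map (demandOf A C) (nonlocal A C)

empty? : ∀ {A : Set} (xs : List A) → Dec (xs ≡ [])
does  (empty? xs)         = null xs
proof (empty? [])      = ofʸ refl
proof (empty? (_ ∷ _)) = ofⁿ (λ ())

Accepted : List Clause → List Clause → Set
Accepted A C = All (Any (Good A C)) C × proj₁ (auction (demands A C)) ≡ []

accepted? : ∀ A C → Dec (Accepted A C)
accepted? A C = all? (any? (good? A C)) C ×-dec empty? (proj₁ (auction (demands A C)))

-- Feasibility of the decision procedure

clauseSet : Ty
clauseSet = list (list word)

containedᶠ : {D S : El a → Clause} → Feasible {a} {list word} D → Feasible {a} {list word} S →
             Feasible (λ x → does (contained? (D x) (S x)))
containedᶠ {S = S} 𝔻 𝕊 = allᶠ (λ x y → y ∈? S x) (memberᶠ sndᶠ (𝕊 ∘ᶠ fstᶠ)) 𝔻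

module _ {A : El a → List Clause} (𝔸 : Feasible {a} {clauseSet} A) where

  localᶠ : {c : El a → Clause} → Feasible {a} {list word} c →
           Feasible (λ x → does (local? (A x) (c x)))
  localᶠ {c} ℂ = anyᶠ (λ x S → contained? (c x) S) (containedᶠ (ℂ ∘ᶠ fstᶠ) sndᶠ) 𝔸

  repᶠ : {x : El a → Variable} → Feasible {a} {word} x → Feasible {a} {word} (λ e → rep (A e) (x e))
  repᶠ {x} 𝕏 = foldr⁺ᶠ {c = word} X small≤
    (ifᶠ (memberᶠ (𝕏 ∘ᶠ envᶠ) eltᶠ) (caseᶠ {b = word} eltᶠ accᶠ eltᶠ) accᶠ) 𝕏 𝔸
    where
    small≤ : ∀ e S r → ∣_∣ {word} (ifᵇ does (x e ∈? S) then caseList r (λ h _ → h) S else r)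
                       ≤ ∣_∣ {word} r + (∣ e ∣ + ∣_∣ {list word} S)
    small≤ e S r with does (x e ∈? S)
    small≤ e S       r | false = m≤m+n _ _
    small≤ e []      r | true  = m≤m+n _ _
    small≤ e (h ∷ S) r | true  =
      ≤-trans (∈⇒∣∣≤ {word} {xs = h ∷ S} (here refl))
        (≤-trans (m≤n+m _ ∣ e ∣) (m≤n+m _ (∣_∣ {word} r)))

  module _ {C : El a → List Clause} (ℂ : Feasible {a} {clauseSet} C) where

    goodᶠ : {x : El a → Variable} → Feasible {a} {word} x →
            Feasible (λ e → does (good? (A e) (C e) (x e)))
    goodᶠ {x} 𝕏 =
      allᶠ (λ e S → (x e ∈? S) →-dec all? (λ D → contained? D S →-dec (x e ∈? D)) (C e))
        (notᶠ (memberᶠ (𝕏 ∘ᶠ fstᶠ) sndᶠ)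
          ∨ᶠ allᶠ (λ (e , S) D → contained? D S →-dec (x e ∈? D))
               (notᶠ (containedᶠ sndᶠ (sndᶠ ∘ᶠ fstᶠ)) ∨ᶠ memberᶠ (𝕏 ∘ᶠ fstᶠ ∘ᶠ fstᶠ) sndᶠ)
               (ℂ ∘ᶠ fstᶠ))
        𝔸

instances : Ty
instances = clauseSet ⊗ clauseSet

demandsᶠ : Feasible {instances} {list demand} (λ (A , C) → demands A C)
demandsᶠ = mapᶠ {b = list word} {c = demand}
  ⟨ sndᶠ , mapᶠ {b = word} {c = word} (repᶠ (fstᶠ ∘ᶠ fstᶠ ∘ᶠ fstᶠ) sndᶠ)
             (filterᶠ (λ ((A , C) , c) → good? A C)
               (goodᶠ (fstᶠ ∘ᶠ fstᶠ ∘ᶠ fstᶠ) (sndᶠ ∘ᶠ fstᶠ ∘ᶠ fstᶠ) sndᶠ) sndᶠ) ⟩ᶠ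
  (filterᶠ (λ (A , C) c → ¬? (local? A c)) (notᶠ (localᶠ (fstᶠ ∘ᶠ fstᶠ) sndᶠ)) sndᶠ)

acceptedᶠ : Feasible {instances} {bool} (λ (A , C) → does (accepted? A C))
acceptedᶠ =
  allᶠ (λ (A , C) c → any? (good? A C) c)
    (anyᶠ (λ ((A , C) , c) x → good? A C x)
      (goodᶠ (fstᶠ ∘ᶠ fstᶠ ∘ᶠ fstᶠ) (sndᶠ ∘ᶠ fstᶠ ∘ᶠ fstᶠ) sndᶠ) sndᶠ)
    sndᶠ
  ∧ᶠ nullᶠ {b = demand} (fstᶠ ∘ᶠ auctionᶠ ∘ᶠ demandsᶠ)

-- Correctness

unique-++⁻ˡ : ∀ {A : Set} (xs : List A) {ys} → Unique (xs ++ ys) → Unique xs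
unique-++⁻ˡ []       !        = []
unique-++⁻ˡ (x ∷ xs) (x∉ ∷ !) = All.++⁻ˡ xs x∉ ∷ unique-++⁻ˡ xs !

unique-++⁻ : ∀ {A : Set} (xs : List A) {ys} → Unique (xs ++ ys) →
             Unique ys × (∀ {x} → x ∈ xs → x ∉ ys)
unique-++⁻ []       ys!         = ys! , λ ()
unique-++⁻ (x ∷ xs) (x∉ ∷ rest!) with ys! , disjoint ← unique-++⁻ xs rest! =
  ys! , λ { (here refl) x∈ys → All.lookup x∉ (∈-++⁺ʳ xs x∈ys) refl
          ; (there z∈xs)     → disjoint z∈xs }

unique-concat⇒≡ : ∀ {A : Set} {xss : List (List A)} → Unique (concat xss) →
                  ∀ {xs ys x} → xs ∈ xss → ys ∈ xss → x ∈ xs → x ∈ ys → xs ≡ ys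
unique-concat⇒≡ {xss = zs ∷ xss} ! (here refl) (here refl) x∈xs x∈ys = refl
unique-concat⇒≡ {xss = zs ∷ xss} ! (here refl) (there ys∈) x∈xs x∈ys =
  ⊥-elim (proj₂ (unique-++⁻ zs !) x∈xs (∈-concat⁺′ x∈ys ys∈))
unique-concat⇒≡ {xss = zs ∷ xss} ! (there xs∈) (here refl) x∈xs x∈ys =
  ⊥-elim (proj₂ (unique-++⁻ zs !) x∈ys (∈-concat⁺′ x∈xs xs∈))
unique-concat⇒≡ {xss = zs ∷ xss} ! (there xs∈) (there ys∈) =
  unique-concat⇒≡ (proj₁ (unique-++⁻ zs !)) xs∈ ys∈

unique-concat-nonempty : ∀ {A : Set} {xss : List (List A)} → Unique (concat xss) →
                         (∀ {xs} → xs ∈ xss → ∃ (_∈ xs)) → Unique xss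
unique-concat-nonempty {xss = []}       ! nonempty = []
unique-concat-nonempty {xss = xs ∷ xss} ! nonempty =
  All.tabulate (λ { ys∈ refl → let _ , x∈ = nonempty (here refl) in
                    proj₂ (unique-++⁻ xs !) x∈ (∈-concat⁺′ x∈ ys∈) })
  ∷ unique-concat-nonempty (proj₁ (unique-++⁻ xs !)) (λ ys∈ → nonempty (there ys∈))

unique-concat-filter : ∀ {A : Set} {P : List A → Set} (P? : ∀ xs → Dec (P xs)) xss →
                       Unique (concat xss) → Unique (concat (filter P? xss))
unique-concat-filter P? []         !  = []
unique-concat-filter P? (xs ∷ xss) !  with does (P? xs)
... | false = unique-concat-filter P? xss (proj₁ (unique-++⁻ xs !))
... | true  = Unique.++⁺ (unique-++⁻ˡ xs !) (unique-concat-filter P? xss (proj₁ (unique-++⁻ xs !)))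
  λ (x∈xs , x∈) → let ys , x∈ys , ys∈ = ∈-concat⁻′ (filter P? xss) x∈ in
    proj₂ (unique-++⁻ xs !) x∈xs (∈-concat⁺′ x∈ys (proj₁ (∈-filter⁻ P? {xs = xss} ys∈)))

filter-interleaving : ∀ {A : Set} {P : A → Set} (P? : ∀ x → Dec (P x)) {xs ys zs} →
                      Interleaving xs ys zs → All (λ y → ¬ P y) ys → filter P? zs ≡ filter P? xs
filter-interleaving P? []            []         = refl
filter-interleaving P? {x ∷ _} (refl ∷ˡ split) ¬ys with does (P? x)
... | false = filter-interleaving P? split ¬ys
... | true  = cong (x ∷_) (filter-interleaving P? split ¬ys)
filter-interleaving P? (refl ∷ʳ split) (¬y ∷ ¬ys) =
  trans (filter-reject P? ¬y) (filter-interleaving P? split ¬ys)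

allPairs-lookup : ∀ {A : Set} {R : A → A → Set} {xs x y} → AllPairs R xs →
                  x ∈ xs → y ∈ xs → x ≡ y ⊎ R x y ⊎ R y x
allPairs-lookup (Rx ∷ R!) (here refl) (here refl) = inj₁ refl
allPairs-lookup (Rx ∷ R!) (here refl) (there y∈)  = inj₂ (inj₁ (All.lookup Rx y∈))
allPairs-lookup (Ry ∷ R!) (there x∈)  (here refl) = inj₂ (inj₂ (All.lookup Ry x∈))
allPairs-lookup (_ ∷ R!)  (there x∈)  (there y∈)  = allPairs-lookup R! x∈ y∈

unique⇒allPairs : ∀ {A : Set} {R : A → A → Set} {xs} → Unique xs →
                  (∀ {x y} → x ∈ xs → y ∈ xs → x ≢ y → R x y) → AllPairs R xs
unique⇒allPairs []        R = []
unique⇒allPairs (x∉ ∷ xs!) R =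
  All.tabulate (λ y∈ → R (here refl) (there y∈) (All.lookup x∉ y∈))
  ∷ unique⇒allPairs xs! (λ x∈ y∈ → R (there x∈) (there y∈))

unique-concat⇒unique : ∀ {A : Set} {xss : List (List A)} → Unique (concat xss) →
                       ∀ {xs} → xs ∈ xss → Unique xs
unique-concat⇒unique {xss = ys ∷ _} ! (there xs∈) =
  unique-concat⇒unique (proj₁ (unique-++⁻ ys !)) xs∈
unique-concat⇒unique {xss = ys ∷ _} ! (here refl) = unique-++⁻ˡ ys !

-- Representatives of variables

rep-fixed : ∀ A x → rep A x ≡ x ⊎ ∃[ S ] S ∈ A × x ∈ S × rep A x ∈ S
rep-fixed []            x = inj₁ refl
rep-fixed (S ∷ A)       x with x ∈? S
rep-fixed ((h ∷ S) ∷ A) x | yes x∈S = inj₂ (h ∷ S , here refl , x∈S , here refl)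
rep-fixed (S ∷ A)       x | no _ with rep-fixed A x
... | inj₁ eq                     = inj₁ eq
... | inj₂ (S′ , S′∈ , x∈ , rep∈) = inj₂ (S′ , there S′∈ , x∈ , rep∈)

rep-together : ∀ {A} → Unique (concat A) → ∀ {S x y} → S ∈ A → x ∈ S → y ∈ S → rep A x ≡ rep A y
rep-together {S₀ ∷ A} ! {S} {x} {y} S∈ x∈S y∈S with x ∈? S₀ | y ∈? S₀ | S∈
rep-together {(h ∷ _) ∷ A} ! S∈ x∈S y∈S | yes _    | yes _    | _         = refl
... | yes x∈S₀ | no y∉S₀  | S∈′
  with refl ← unique-concat⇒≡ ! (here refl) S∈′ x∈S₀ x∈S = ⊥-elim (y∉S₀ y∈S)
... | no x∉S₀  | yes y∈S₀ | S∈′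
  with refl ← unique-concat⇒≡ ! (here refl) S∈′ y∈S₀ y∈S = ⊥-elim (x∉S₀ x∈S)
... | no x∉S₀  | no _     | here refl = ⊥-elim (x∉S₀ x∈S)
... | no _     | no _     | there S∈′ = rep-together (proj₁ (unique-++⁻ S₀ !)) S∈′ x∈S y∈S

-- As the statements are disjoint, a head lies in its own statement only. Together with
-- `rep-together`, this makes the classes of `rep A` the statements and the single variables outside
-- them.
rep-injective : ∀ {A} → Unique (concat A) → ∀ x y → rep A x ≡ rep A y →
                x ≡ y ⊎ ∃[ S ] S ∈ A × x ∈ S × y ∈ S
rep-injective {[]}          ! x y eq = inj₁ eq
rep-injective {S ∷ A}       ! x y eq with x ∈? S | y ∈? S
rep-injective {(h ∷ S) ∷ A} ! x y eq | yes x∈S | yes y∈S = inj₂ (h ∷ S , here refl , x∈S , y∈S)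
rep-injective {(h ∷ S) ∷ A} ! x y eq | yes x∈S | no y∉S with rep-fixed A y
... | inj₁ fixed = ⊥-elim (y∉S (here (trans (sym fixed) (sym eq))))
... | inj₂ (S′ , S′∈ , _ , rep∈) =
  ⊥-elim (proj₂ (unique-++⁻ (h ∷ S) !) (here (sym eq)) (∈-concat⁺′ rep∈ S′∈))
rep-injective {(h ∷ S) ∷ A} ! x y eq | no x∉S | yes y∈S with rep-fixed A x
... | inj₁ fixed = ⊥-elim (x∉S (here (trans (sym fixed) eq)))
... | inj₂ (S′ , S′∈ , _ , rep∈) =
  ⊥-elim (proj₂ (unique-++⁻ (h ∷ S) !) (here eq) (∈-concat⁺′ rep∈ S′∈))
rep-injective {S ∷ A} ! x y eq | no _ | no _ with rep-injective (proj₁ (unique-++⁻ S !)) x y eq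
... | inj₁ x≡y                    = inj₁ x≡y
... | inj₂ (S′ , S′∈ , x∈ , y∈)   = inj₂ (S′ , there S′∈ , x∈ , y∈)

-- The model makes a variable true iff it leads its class under `rep A`. A leader depends only on
-- the class, so no class has two true variables.
leader : (Variable → Variable) → List Variable → Variable → Variable
-- For a class of `rep A` that does not meet the list, this default makes its representative true.
-- That is harmless: the clauses are positive, and the class still has only one true variable.
leader f []      r = r
leader f (y ∷ Z) r = caseDec (f y ≟ʷ r)
  where
  caseDec : ∀ {P : Set} → Dec P → Variable
  caseDec (yes _) = y
  caseDec (no _)  = leader f Z r

leader-∈ : ∀ f {Z y} → y ∈ Z → leader f Z (f y) ∈ Z × f (leader f Z (f y)) ≡ f y
leader-∈ f {z ∷ Z} {y} y∈ with f z ≟ʷ f y | y∈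
... | yes eq | _          = here refl , eq
... | no fz≢ | here refl  = ⊥-elim (fz≢ refl)
... | no _   | there y∈′ with l∈ , eq ← leader-∈ f y∈′ = there l∈ , eq

leader-first : ∀ f {xs Z x} → AllPairs (λ y z → f y ≢ f z) xs → x ∈ xs →
               leader f (xs ++ Z) (f x) ≡ x
leader-first f {y ∷ xs} {Z} {x} (y≢ ∷ xs!) x∈ with f y ≟ʷ f x | x∈
... | yes _  | here refl = refl
... | yes eq | there x∈′ = ⊥-elim (All.lookup y≢ x∈′ eq)
... | no fy≢ | here refl = ⊥-elim (fy≢ refl)
... | no _   | there x∈′ = leader-first f xs! x∈′

-- Acceptance and satisfiability

module _ {A C : List Clause} (A! : Unique (concat A)) (N! : Unique (concat (nonlocal A C))) where

  private
    N  = nonlocal A C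
    ds = demands A C

  nonlocal-⊆ : N ⊆ C
  nonlocal-⊆ c∈N = proj₁ (∈-filter⁻ (λ c → ¬? (local? A c)) {xs = C} c∈N)

  -- Disjointness alone would permit repeated empty clauses; a good variable in each clause excludes
  -- them.
  demand-unique : All (Any (Good A C)) C → Unique ds
  demand-unique good = Unique.map⁺ (cong proj₁) (unique-concat-nonempty N! λ c∈N →
    let x , x∈c , _ = find (All.lookup good (nonlocal-⊆ c∈N))
    in x , x∈c)

  module _ {α : Assignment} (atMost : All (λ S → α ⊨ ⊕≤1 S) A)
           (clause : All (λ c → α ⊨ ⋁ c) C) where

    true-unique : ∀ {S x y} → S ∈ A → x ∈ S → y ∈ S → T (α x) → T (α y) → x ≡ y
    true-unique S∈ x∈ y∈ αx αy with allPairs-lookup (All.lookup atMost S∈) x∈ y∈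
    ... | inj₁ eq               = eq
    ... | inj₂ (inj₁ (inj₁ ¬αx)) = ⊥-elim (¬αx αx)
    ... | inj₂ (inj₁ (inj₂ ¬αy)) = ⊥-elim (¬αy αy)
    ... | inj₂ (inj₂ (inj₁ ¬αy)) = ⊥-elim (¬αy αy)
    ... | inj₂ (inj₂ (inj₂ ¬αx)) = ⊥-elim (¬αx αx)

    true-good : ∀ {x} → T (α x) → Good A C x
    true-good {x} αx = All.tabulate λ S∈ x∈S → All.tabulate λ D∈ D⊆S →
      let y , y∈D , αy = find (All.lookup clause D∈) in
      subst (_∈ _) (true-unique S∈ (All.lookup D⊆S y∈D) x∈S αy αx) y∈D

    all-good : All (Any (Good A C)) C
    all-good = All.map (Any.map true-good) clause

    -- True variables with the same representative coincide or lie in one statement, hence are equal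
    -- in either case; disjoint clauses that share a variable are the same.
    model-represents : Represents (λ d w → ∃[ x ] x ∈ proj₁ d × T (α x) × rep A x ≡ w) ds
    model-represents = record { represented = represented ; distinct = distinct }
      where
      represented : ∀ {d} → d ∈ ds → ∃[ w ] w ∈ slots d × ∃[ x ] x ∈ proj₁ d × T (α x) × rep A x ≡ w
      represented d∈ with c , c∈N , refl ← ∈-map⁻ (demandOf A C) d∈
        with x , x∈c , αx ← find (All.lookup clause (nonlocal-⊆ c∈N)) =
        rep A x , ∈-map⁺ (rep A) (∈-filter⁺ (good? A C) x∈c (true-good αx)) , x , x∈c , αx , refl
      distinct : ∀ {d d′ w} → d ∈ ds → d′ ∈ ds →
                 ∃[ x ] x ∈ proj₁ d × T (α x) × rep A x ≡ w →
                 ∃[ x ] x ∈ proj₁ d′ × T (α x) × rep A x ≡ w → d ≡ d′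
      distinct d∈ d′∈ (x , x∈ , αx , eq) (x′ , x′∈ , αx′ , eq′)
        with c  , c∈N  , refl ← ∈-map⁻ (demandOf A C) d∈
        with c′ , c′∈N , refl ← ∈-map⁻ (demandOf A C) d′∈
        with rep-injective A! x x′ (trans eq (sym eq′))
      ... | inj₁ refl = cong (demandOf A C) (unique-concat⇒≡ N! c∈N c′∈N x∈ x′∈)
      ... | inj₂ (S , S∈ , x∈S , x′∈S) with refl ← true-unique S∈ x∈S x′∈S αx αx′ =
        cong (demandOf A C) (unique-concat⇒≡ N! c∈N c′∈N x∈ x′∈)

    model⇒accepted : Accepted A C
    model⇒accepted = all-good , auction-complete model-represents (demand-unique all-good)

  module _ {R : Demand → Variable → Set} (good : All (Any (Good A C)) C) (represents : Represents R ds) where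

    open Represents represents

    Chosen : Clause → Variable → Set
    Chosen c x = c ∈ N × x ∈ c × Good A C x × R (demandOf A C c) (rep A x)

    chosen-injective : ∀ {c c′ x x′} → Chosen c x → Chosen c′ x′ → rep A x ≡ rep A x′ → c ≡ c′
    chosen-injective (c∈ , _ , _ , Rx) (c′∈ , _ , _ , Rx′) eq =
      cong proj₁ (distinct (∈-map⁺ (demandOf A C) c∈) (∈-map⁺ (demandOf A C) c′∈) Rx
                           (subst (R _) (sym eq) Rx′))

    choose : ∀ {c} → c ∈ N → ∃ (Chosen c)
    choose {c} c∈ with w , w∈ , Rw ← represented (∈-map⁺ (demandOf A C) c∈)
      with x , x∈ , refl ← ∈-map⁻ (rep A) w∈
      with x∈c , good-x ← ∈-filter⁻ (good? A C) {xs = c} x∈ = x , c∈ , x∈c , good-x , Rw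

    N-unique : Unique N
    N-unique = Unique.map⁻ (demand-unique good)

    -- Chosen variables come first in Z, so they lead the variables sharing
    -- their representative.
    represents⇒model : ∃[ α ] All (λ S → α ⊨ ⊕≤1 S) A × All (λ c → α ⊨ ⋁ c) C
    represents⇒model
      with xs , _ , xs! , from , to ←
             image (rep A) chosen-injective N-unique (All.tabulate choose) =
      α , All.tabulate atMost , All.tabulate clause
      where
      Z = xs ++ filter (good? A C) (concat C)
      lead : Variable → Variable
      lead x = leader (rep A) Z (rep A x)
      α : Assignment
      α x = isYes (lead x ≟ʷ x)
      Z-good : ∀ {x} → x ∈ Z → Good A C x
      Z-good x∈ with ∈-++⁻ xs x∈
      ... | inj₁ x∈xs = let _ , _ , _ , _ , good-x , _ = All.lookup from x∈xs in good-x
      ... | inj₂ x∈   = proj₂ (∈-filter⁻ (good? A C) {xs = concat C} x∈)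
      atMost : ∀ {S} → S ∈ A → α ⊨ ⊕≤1 S
      atMost S∈ = unique⇒allPairs (unique-concat⇒unique A! S∈) separate
        where
        separate : ∀ {x y} → x ∈ _ → y ∈ _ → x ≢ y → ¬ T (α x) ⊎ ¬ T (α y)
        separate {x} {y} x∈ y∈ x≢y with lead x ≟ʷ x | lead y ≟ʷ y
        ... | no _   | _      = inj₁ λ ()
        ... | yes _  | no _   = inj₂ λ ()
        ... | yes lx | yes ly = ⊥-elim (x≢y (trans (sym lx)
          (trans (cong (leader (rep A) Z) (rep-together A! S∈ x∈ y∈)) ly)))
      clause : ∀ {c} → c ∈ C → α ⊨ ⋁ c
      clause {c} c∈ with local? A c
      -- The variable chosen for c leads its class, so it is true.
      ... | no nonlocal-c =
        let c∈N = ∈-filter⁺ (λ c → ¬? (local? A c)) c∈ nonlocal-c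
            x , x∈xs , _ , x∈c , _ = find (All.lookup to c∈N)
        in lose x∈c (fromWitness (leader-first (rep A) xs! x∈xs))
      -- The leader of the class of a good variable of c is itself good and lies in S, so goodness
      -- puts it into c. It is its own leader, hence true.
      ... | yes local-c
        with S , S∈ , c⊆S ← find local-c
        with x , x∈c , good-x ← find (All.lookup good c∈)
        with y∈Z , eq ← leader-∈ (rep A) {Z}
               (∈-++⁺ʳ xs (∈-filter⁺ (good? A C) (∈-concat⁺′ x∈c c∈) good-x)) =
        lose (All.lookup (All.lookup (Z-good y∈Z) S∈ y∈S) c∈ c⊆S)
             (fromWitness (cong (leader (rep A) Z) eq))
        where
        y∈S : lead x ∈ S
        y∈S with rep-injective A! (lead x) x eq
        ... | inj₁ y≡x = subst (_∈ S) (sym y≡x) (All.lookup c⊆S x∈c)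
        ... | inj₂ (S′ , S′∈ , y∈S′ , x∈S′) =
          subst (lead x ∈_) (unique-concat⇒≡ A! S′∈ S∈ x∈S′ (All.lookup c⊆S x∈c)) y∈S′

  accepted⇒model : Accepted A C → ∃[ α ] All (λ S → α ⊨ ⊕≤1 S) A × All (λ c → α ⊨ ⋁ c) C
  accepted⇒model (good , Q≡[]) = represents⇒model good (auction-sound (demand-unique good) Q≡[])

-- Formulas and their encodings

formula : Ty
formula = list (bool ⊗ list word)

untag : Formula → El formula
untag = map λ { (⊕≤1 as) → false , as ; (⋁ as) → true , as }

enc-untag : ∀ φ → enc {formula} (untag φ) ≡ encodeList encodeConstraint φ
enc-untag []           = refl
enc-untag (⊕≤1 as ∷ φ) = cong (_ ∙_) (enc-untag φ)
enc-untag (⋁ as ∷ φ)   = cong (_ ∙_) (enc-untag φ)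

untagged-atMostOnes untagged-clauses : El formula → List Clause
untagged-atMostOnes ψ = map proj₂ (filter (λ c → ¬? (T? (proj₁ c))) ψ)
untagged-clauses    ψ = map proj₂ (filter (λ c → T? (proj₁ c)) ψ)

untagged-atMostOnes-correct : ∀ φ → untagged-atMostOnes (untag φ) ≡ atMostOnes φ
untagged-atMostOnes-correct []           = refl
untagged-atMostOnes-correct (⊕≤1 as ∷ φ) = cong (as ∷_) (untagged-atMostOnes-correct φ)
untagged-atMostOnes-correct (⋁ _ ∷ φ)    = untagged-atMostOnes-correct φ

untagged-clauses-correct : ∀ φ → untagged-clauses (untag φ) ≡ clauses φ
untagged-clauses-correct []          = refl
untagged-clauses-correct (⊕≤1 _ ∷ φ) = untagged-clauses-correct φ
untagged-clauses-correct (⋁ as ∷ φ)  = cong (as ∷_) (untagged-clauses-correct φ)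

decideᶠ : Feasible {formula} {bool}
            (λ ψ → does (accepted? (untagged-atMostOnes ψ) (untagged-clauses ψ)))
decideᶠ = acceptedᶠ ∘ᶠ
  ⟨ mapᶠ {b = bool ⊗ list word} {c = list word} (sndᶠ ∘ᶠ sndᶠ)
      (filterᶠ (λ _ c → ¬? (T? (proj₁ c))) (notᶠ (fstᶠ ∘ᶠ sndᶠ)) idᶠ)
  , mapᶠ {b = bool ⊗ list word} {c = list word} (sndᶠ ∘ᶠ sndᶠ)
      (filterᶠ (λ _ c → T? (proj₁ c)) (fstᶠ ∘ᶠ sndᶠ) idᶠ) ⟩ᶠ

decide-correct : ∀ φ → does (accepted? (untagged-atMostOnes (untag φ)) (untagged-clauses (untag φ)))
                       ≡ does (accepted? (atMostOnes φ) (clauses φ))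
decide-correct φ = cong₂ (λ A C → does (accepted? A C))
  (untagged-atMostOnes-correct φ) (untagged-clauses-correct φ)

satisfies⁺ : ∀ {α} φ → All (λ S → α ⊨ ⊕≤1 S) (atMostOnes φ) → All (λ c → α ⊨ ⋁ c) (clauses φ) →
             All (α ⊨_) φ
satisfies⁺ []          _          _          = []
satisfies⁺ (⊕≤1 _ ∷ φ) (αS ∷ αA) αC        = αS ∷ satisfies⁺ φ αA αC
satisfies⁺ (⋁ _ ∷ φ)   αA        (αc ∷ αC) = αc ∷ satisfies⁺ φ αA αC

satisfies⁻ : ∀ {α} φ → All (α ⊨_) φ →
             All (λ S → α ⊨ ⊕≤1 S) (atMostOnes φ) × All (λ c → α ⊨ ⋁ c) (clauses φ)
satisfies⁻ []          []       = [] , []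
satisfies⁻ (⊕≤1 _ ∷ φ) (α⊨ ∷ α⊨φ) with αA , αC ← satisfies⁻ φ α⊨φ = α⊨ ∷ αA , αC
satisfies⁻ (⋁ _ ∷ φ)   (α⊨ ∷ α⊨φ) with αA , αC ← satisfies⁻ φ α⊨φ = αA , α⊨ ∷ αC

-- A nonlocal clause cannot belong to the second group.

nonlocal-unique : ∀ {φ} → Admissible φ → Unique (concat (nonlocal (atMostOnes φ) (clauses φ)))
nonlocal-unique {φ} adm =
  subst (λ N → Unique (concat N))
    (sym (filter-interleaving nonlocal? grouping
      (All.map (λ c⊆A ¬local → ¬local
        (Any.map (λ c⊆S → All.tabulate (λ x∈c → c⊆S x∈c)) c⊆A)) group₂-local)))
    (unique-concat-filter nonlocal? group₁ group₁-unique)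
  where
  open Admissible adm
  nonlocal? = λ c → ¬? (local? (atMostOnes φ) c)

-- The promise enters the proof that acceptance means satisfiability; the test is a function of the
-- formula alone, so a program can compute its outcome.
satisfiable? : ∀ φ → Admissible φ → Dec (Satisfiable φ)
satisfiable? φ adm = map′ sound complete (accepted? (atMostOnes φ) (clauses φ))
  where
  A! = Admissible.atMostOnes-unique adm
  N! = nonlocal-unique adm
  sound : Accepted (atMostOnes φ) (clauses φ) → Satisfiable φ
  sound accepted =
    let α , αA , αC = accepted⇒model {atMostOnes φ} {clauses φ} A! N! accepted
    in α , satisfies⁺ φ αA αC
  complete : Satisfiable φ → Accepted (atMostOnes φ) (clauses φ)
  complete (α , α⊨φ) =
    let αA , αC = satisfies⁻ φ α⊨φ
    in model⇒accepted {atMostOnes φ} {clauses φ} A! N! αA αC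

feasible⇒decidable : {f : El formula → Bool} → Feasible f →
                     (∀ φ → Admissible φ → Σ (Dec (Satisfiable φ)) λ d → f (untag φ) ≡ does d) →
                     DecidableInPolynomialTime AdmissibleSAT
feasible⇒decidable {f} F decides = program 1 (F .code) , toPolynomial (F .bound) , correct
  where
  correct : ∀ φ → Admissible φ → Σ (Dec (Satisfiable φ)) λ d →
            program 1 (F .code) maps encodeList encodeConstraint φ to encodeBool (does d)
              within ⟦ toPolynomial (F .bound) ⟧ (size (encodeList encodeConstraint φ))
  correct φ adm with t , run , t≤ ← F .runs (untag φ) nil | d , eq ← decides φ adm =
    d , encodeBool (f (untag φ)) ∷ nil ∷ [] , t ,
    subst (λ x → F .code ⊢ x ∷ nil ∷ [] ⇓ encodeBool (f (untag φ)) ∷ nil ∷ [] [ t ])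
      (enc-untag φ) run ,
    cong encodeBool eq ,
    subst (t ≤_) (trans (cong (λ x → F .bound at size x) (enc-untag φ))
                        (sym (toPolynomial-correct (F .bound) _)))
      (m+n≤o⇒m≤o t t≤)

admissibleSAT-decidable : DecidableInPolynomialTime AdmissibleSAT
admissibleSAT-decidable = feasible⇒decidable decideᶠ λ φ adm → satisfiable? φ adm , decide-correct φ

-- The reduction decides the instance and outputs a fixed yes- or no-instance.

decidable⇒≤ᵖ : ∀ {P Q} (let open Problem Q) → DecidableInPolynomialTime P →
               (y n : Instance) → Promise y → Promise n → Yes y → ¬ Yes n → P ≤ᵖ Q
decidable⇒≤ᵖ {P} {Q} (program extra body , p , decides) y n y✓ n✓ yes-y ¬yes-n =
  program extra (body ⨾ if var zero then (zero := Y) else (zero := N)) , q , reduces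
  where
  open Problem
  Y N : Expr (suc extra)
  Y = quoteTree (Q .encode y)
  N = quoteTree (Q .encode n)
  -- The test takes 2 units and the assignment 1 besides its expression. The output sizes are
  -- included because `q` has to bound the output as well.
  slack = 3 + (cost Y + cost N) + (size (Q .encode y) + size (Q .encode n))
  q = addᴾ p (slack ∷ [])
  inputSize : P .Instance → ℕ
  inputSize x = size (P .encode x)
  q-correct : ∀ m → ⟦ q ⟧ m ≡ ⟦ p ⟧ m + slack
  q-correct m rewrite addᴾ-correct p (slack ∷ []) m | *-zeroʳ m | +-identityʳ slack = refl
  fits : ∀ {t} m k → k ≤ slack → t ≤ ⟦ p ⟧ m → t + k ≤ ⟦ q ⟧ m
  fits m k k≤ t≤ = ≤-trans (+-mono-≤ t≤ k≤) (≤-reflexive (sym (q-correct m)))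
  costs sizes : ℕ
  costs = cost Y + cost N
  sizes = size (Q .encode y) + size (Q .encode n)
  Y≤ : 3 + cost Y ≤ slack
  Y≤ = ≤-trans (+-monoʳ-≤ 3 (m≤m+n _ (cost N))) (m≤m+n (3 + costs) sizes)
  N≤ : 3 + cost N ≤ slack
  N≤ = ≤-trans (+-monoʳ-≤ 3 (m≤n+m _ (cost Y))) (m≤m+n (3 + costs) sizes)
  y≤ : ∀ m → size (Q .encode y) ≤ ⟦ q ⟧ m
  y≤ m = fits m _ (≤-trans (m≤m+n _ (size (Q .encode n))) (m≤n+m sizes (3 + costs))) z≤n
  n≤ : ∀ m → size (Q .encode n) ≤ ⟦ q ⟧ m
  n≤ m = fits m _ (≤-trans (m≤n+m _ (size (Q .encode y))) (m≤n+m sizes (3 + costs))) z≤n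
  reduces : ∀ x → P .Promise x → _
  reduces x x✓ with decides x x✓
  ... | yes yes-x , τ ∷ τs , t , run , refl , t≤ =
    y , y✓ , mk⇔ (λ _ → yes-y) (λ _ → yes-x) ,
    (_ , _ , seq run (if-true (λ ()) assign) , eval-quoteTree _ _ ,
      fits (inputSize x) (3 + cost Y) Y≤ t≤) , y≤ (inputSize x)
  ... | no ¬yes-x , τ ∷ τs , t , run , refl , t≤ =
    n , n✓ , mk⇔ (λ yes-x → ⊥-elim (¬yes-x yes-x)) (λ yes-n → ⊥-elim (¬yes-n yes-n)) ,
    (_ , _ , seq run (if-false refl assign) , eval-quoteTree _ _ ,
      fits (inputSize x) (3 + cost N) N≤ t≤) , n≤ (inputSize x)

-- A solvable and an unsolvable marriage instance

emptyMarriage unmarriable : Marriage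
emptyMarriage = record { girls = 0 ; boys = 0 ; girlLists = [] ; boyLists = [] }
unmarriable   = record { girls = 1 ; boys = 0 ; girlLists = just [] ∷ [] ; boyLists = [] }

emptyMarriage-solution : Solution emptyMarriage
emptyMarriage-solution = record
  { pairs = [] ; disjoint = [] ; covers-girls = λ () ; covers-boys = λ ()
  ; girls-accept = [] ; boys-accept = [] }

unmarriable-unsolvable : ¬ Solution unmarriable
unmarriable-unsolvable solution
  with (_ , ()) , _ ← ∈-map⁻ proj₁ (Solution.covers-girls solution zero (MaybeAny.just tt))

theorem7 : DecidableInPolynomialTime AdmissibleSAT × (AdmissibleSAT ≤ᵖ SymmetricMarriage)
theorem7 = admissibleSAT-decidable ,
  decidable⇒≤ᵖ admissibleSAT-decidable emptyMarriage unmarriable tt tt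
    emptyMarriage-solution unmarriable-unsolvable
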